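{- For every $\epsilon > 0$ there is an algorithm for the problem of maximizing a DR-submodular function $f:[0,1]^n \to \mathbb{R}_+$ over $[0,1]^n$ with the following guarantees: (i) the algorithm is deterministic, given oracle access for evaluating $f$ and its gradient $\nabla f$; (ii) it returns a point $\vec{x} \in [0,1]^n$ with $f(\vec{x}) \ge \left(\tfrac{1}{2} - \epsilon\right)\max_{\vec{z} \in [0,1]^n} f(\vec{z})$; (iii) the number of rounds of adaptivity and the number of evaluations of $f$ and $\nabla f$ are $O\!\left(\frac{\log(1/\epsilon)}{\epsilon}\right)$.
   Context: A function $f:[0,1]^n \to \mathbb{R}_+$ (non-negative) is DR-submodular if for all $\vec{x} \le \vec{y}$ in $[0,1]^n$ (coordinate-wise), all $i \in [n]$ and all $\delta \in [0,1]$ such that $\vec{x}+\delta\vec{1}_{\{i\}}$ and $\vec{y}+\delta\vec{1}_{\{i\}}$ lie in $[0,1]^n$, one has $f(\vec{x}+\delta\vec{1}_{\{i\}}) - f(\vec{x}) \ge f(\vec{y}+\delta\vec{1}_{\{i\}}) - f(\vec{y})$, where $\vec{1}_{\{i\}}$ is the $i$-th standard basis vector. Throughout, $f$ is assumed differentiable (so DR-submodularity is equivalent to $\nabla f(\vec{x}) \ge \nabla f(\vec{y})$ whenever $\vec{x} \le \vec{y}$), and $f$ is extended to $\mathbb{R}^n_+$ by $f(\vec{x}) = f(\vec{x} \wedge \vec{1})$ with $(\vec{x}\wedge\vec{1})_i = \min\{x_i,1\}$. The algorithm accesses $f$ only through an oracle returning $f(\vec{z})$ and $\nabla f(\vec{z})$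 for queried points $\vec{z}$. The adaptivity of an algorithm is the number of sequential rounds of oracle queries it makes, where in each round it may issue polynomially many queries in parallel, chosen based only on answers from previous rounds. -}

module Defs where

open import Algebra.Bundles using (CommutativeRing; Semiring)
open import Algebra.Structures using (IsCommutativeRing)
import Algebra.Construct.NaturalChoice.Max as Max
import Algebra.Definitions.RawSemiring as RawSemiringDefs
open import Data.Fin.Base using (Fin)
open import Data.Nat.Base as ℕ using (ℕ; suc)
open import Data.Product.Base using (Σ-syntax; ∃; ∃-syntax; _×_; _,_; proj₁)
open import Data.Vec.Base using (Vec; map; zipWith; foldr′; _[_]%=_)
open import Data.Vec.Relation.Unary.All using (All)
open import Data.Vec.Relation.Binary.Pointwise.Inductive using (Pointwise)
open import Level using (0ℓ)
open import Relation.Binary.Bundles using (TotalOrder)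
open import Relation.Binary.Core using (Rel)
open import Relation.Binary.Structures using (IsTotalOrder)
import Relation.Binary.Construct.NonStrictToStrict as ToStrict
open import Relation.Binary.PropositionalEquality using (_≡_; _≢_)

module _ {A : Set} (_≤_ : Rel A 0ℓ) where

  IsUpperBound : (A → Set) → A → Set
  IsUpperBound S u = ∀ x → S x → x ≤ u

  IsSupremum : (A → Set) → A → Set
  IsSupremum S s = IsUpperBound S s × (∀ u → IsUpperBound S u → s ≤ u)

-- The standard library has no real numbers; ℝ enters through its categorical
-- axiomatisation as the (Dedekind-)complete ordered field.
record CompleteOrderedField : Set₁ where
  infix  8 _⁻¹ -_
  infixl 7 _*_
  infixl 6 _+_
  infix  4 _≤_
  field
    Carrier           : Set
    _+_ _*_           : Carrier → Carrier → Carrier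
    -_                : Carrier → Carrier
    0# 1#             : Carrier
    -- x ⁻¹ is unspecified at x = 0.
    _⁻¹               : Carrier → Carrier
    _≤_               : Rel Carrier 0ℓ
    isCommutativeRing : IsCommutativeRing _≡_ _+_ _*_ -_ 0# 1#
    0≢1               : 0# ≢ 1#
    ⁻¹-inverse        : ∀ x → x ≢ 0# → x * x ⁻¹ ≡ 1#
    isTotalOrder      : IsTotalOrder _≡_ _≤_
    +-mono-≤          : ∀ {x y} z → x ≤ y → x + z ≤ y + z
    *-nonNegative     : ∀ {x y} → 0# ≤ x → 0# ≤ y → 0# ≤ x * y
    complete          : (S : Carrier → Set) → ∃ S → ∃ (IsUpperBound _≤_ S) →
                        ∃ (IsSupremum _≤_ S)

  commutativeRing : CommutativeRing 0ℓ 0ℓ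
  commutativeRing = record { isCommutativeRing = isCommutativeRing }

  totalOrder : TotalOrder 0ℓ 0ℓ 0ℓ
  totalOrder = record { isTotalOrder = isTotalOrder }

  open CommutativeRing commutativeRing public using (_-_)
  open ToStrict _≡_ _≤_ public using (_<_)
  open Max totalOrder public using (_⊔_)
  open RawSemiringDefs (Semiring.rawSemiring (CommutativeRing.semiring commutativeRing)) public
    using (_^_) renaming (_×_ to _·_)

module DRSubmodularMaximization (𝓡 : CompleteOrderedField) where

  open CompleteOrderedField 𝓡 public

  ℝ : Set
  ℝ = Carrier

  fromℕ : ℕ → ℝ
  fromℕ k = k · 1#

  2# ½ : ℝ
  2# = 1# + 1#
  ½  = 2# ⁻¹

  ∣_∣ : ℝ → ℝ
  ∣ x ∣ = x ⊔ (- x)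

  -- log₂ x = sup { r ∈ ℚ : 2ʳ ≤ x }, for x > 0.  The rational r is (a - b) / q
  -- with q = suc k, so that 2ʳ ≤ x reads 2ᵃ ≤ 2ᵇ xᑫ.
  IsLog₂ : ℝ → ℝ → Set
  IsLog₂ x = IsSupremum _≤_ λ r →
    ∃[ a ] ∃[ b ] ∃[ k ] (fromℕ (suc k) * r ≡ fromℕ a - fromℕ b)
                       × (2# ^ a ≤ 2# ^ b * x ^ suc k)

  module _ {n : ℕ} where

    infix 4 _≤ᵛ_
    infixl 6 _-ᵛ_

    _≤ᵛ_ : Rel (Vec ℝ n) 0ℓ
    _≤ᵛ_ = Pointwise _≤_

    _-ᵛ_ : Vec ℝ n → Vec ℝ n → Vec ℝ n
    _-ᵛ_ = zipWith _-_

    ⟨_,_⟩ : Vec ℝ n → Vec ℝ n → ℝ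
    ⟨ u , v ⟩ = foldr′ _+_ 0# (zipWith _*_ u v)

    ‖_‖₁ : Vec ℝ n → ℝ
    ‖ v ‖₁ = foldr′ _+_ 0# (map ∣_∣ v)

    InCube : Vec ℝ n → Set
    InCube = All (λ t → 0# ≤ t × t ≤ 1#)

    -- A function on [0,1]ⁿ is represented by a function on ℝⁿ; every notion
    -- below only involves its values on the cube.

    NonNegative : (Vec ℝ n → ℝ) → Set
    NonNegative f = ∀ x → InCube x → 0# ≤ f x

    infixl 6 _⊕_𝟙⟨_⟩

    _⊕_𝟙⟨_⟩ : Vec ℝ n → ℝ → Fin n → Vec ℝ n
    x ⊕ δ 𝟙⟨ i ⟩ = x [ i ]%= (_+ δ)

    DRSubmodular : (Vec ℝ n → ℝ) → Set
    DRSubmodular f =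
      ∀ x y → InCube x → InCube y → x ≤ᵛ y →
      ∀ i δ → 0# ≤ δ → δ ≤ 1# →
      InCube (x ⊕ δ 𝟙⟨ i ⟩) → InCube (y ⊕ δ 𝟙⟨ i ⟩) →
      f (y ⊕ δ 𝟙⟨ i ⟩) - f y ≤ f (x ⊕ δ 𝟙⟨ i ⟩) - f x

    -- f is (Fréchet) differentiable on the cube with gradient ∇f, increments
    -- being restricted to the cube at its boundary points.
    IsGradient : (Vec ℝ n → ℝ) → (Vec ℝ n → Vec ℝ n) → Set
    IsGradient f ∇f =
      ∀ x → InCube x → ∀ η → 0# < η →
      ∃[ δ ] (0# < δ) × (∀ y → InCube y → ‖ y -ᵛ x ‖₁ < δ →
        ∣ f y - f x - ⟨ ∇f x , y -ᵛ x ⟩ ∣ ≤ η * ‖ y -ᵛ x ‖₁)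

  Cube : ℕ → Set
  Cube n = Σ[ x ∈ Vec ℝ n ] InCube x

  -- A deterministic adaptive algorithm, as a well-founded decision tree.  In
  -- each round it issues k parallel queries z and receives the pairs
  -- (f z , ∇f z); what it does next is a function of the answers so far.
  data Algorithm (n : ℕ) : Set where
    return : Cube n → Algorithm n
    round  : ∀ {k} → Vec (Cube n) k → (Vec (ℝ × Vec ℝ n) k → Algorithm n) →
             Algorithm n

  module _ {n : ℕ} (f : Vec ℝ n → ℝ) (∇f : Vec ℝ n → Vec ℝ n) where

    oracle : Cube n → ℝ × Vec ℝ n
    oracle (z , _) = f z , ∇f z

    output : Algorithm n → Vec ℝ n
    output (return x)      = proj₁ x
    output (round zs next) = output (next (map oracle zs))

    rounds : Algorithm n → ℕ
    rounds (return _)      = 0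
    rounds (round zs next) = suc (rounds (next (map oracle zs)))

    -- The number of evaluations of f, which is also that of ∇f.
    evaluations : Algorithm n → ℕ
    evaluations (return _)          = 0
    evaluations (round {k} zs next) = k ℕ.+ evaluations (next (map oracle zs))

{-# OPTIONS --safe #-}
module Submission where

-- Double greedy with fixed step sizes.  A lower point x and an upper point y
-- with y - x constant approach each other; a step of length δ raises xᵢ by δ rᵢ
-- and lowers yᵢ by δ (1 - rᵢ), where rᵢ balances aᵢ = ∂ᵢf(x) and bᵢ = -∂ᵢf(y).
-- The usual argument compares the loss of f on the clamped optimum with half
-- the gain of f(x) + f(y), up to an error δ (S - S′) for S = Σ (aᵢ + bᵢ), which
-- decreases along the run.  If the clock starts at t₀ with x = t₀ and y = 1 - t₀,
-- and no step exceeds the fraction η of the time on the clock, then summation by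
-- parts bounds the total error by η t₀ S₀ + η Σ δ S.  Here Σ δ S is at most twice
-- the first-order gain, and t₀ S₀ ≤ f(x) + f(y) at the start by concavity, so the
-- error is O(η) times the value returned.  Starting at t₀ costs a further factor
-- 1 - 2t₀.  With η, t₀ ≤ ε/2, taking M = 1/η equal steps per doubling of the
-- clock gives O(log(1/ε)/ε) steps of two queries each.

open import Defs
open import Algebra.Bundles using (CommutativeRing; Ring)
import Algebra.Construct.NaturalChoice.Max as Max
import Algebra.Properties.Ring as RingProperties
import Algebra.Properties.Semiring.Exp as SemiringExp
import Algebra.Properties.Semiring.Mult as SemiringMult
import Algebra.Properties.Semiring.Mult.TCOptimised as SemiringMult′
import Algebra.Properties.Semiring.Sum as SemiringSum
import Algebra.Solver.Ring as RingSolver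
open import Algebra.Solver.Ring.AlmostCommutativeRing using (fromCommutativeRing; _-Raw-AlmostCommutative⟶_)
open import Axiom.ExcludedMiddle using (ExcludedMiddle)
open import Data.Fin.Base using (Fin; zero; suc)
open import Data.Integer.Base as ℤ using (ℤ; +_; -[1+_]; _⊖_; _◃_)
import Data.Integer.Properties as ℤ
open import Data.List.Base using (List; []; _∷_; _++_; replicate; foldr; length)
open import Data.List.Properties using (length-++; length-replicate)
open import Data.List.Relation.Unary.All as ListAll using ([]; _∷_)
open import Data.List.Relation.Unary.All.Properties using (++⁺; replicate⁺)
import Data.Maybe.Base as Maybe
open import Data.Nat.Base as ℕ using (ℕ; zero; suc; z≤n; s≤s)
open import Data.Nat.Properties using (m≤m*n; +-suc)
open import Data.Product.Base using (Σ-syntax; ∃; ∃-syntax; _×_; _,_; proj₁; proj₂)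
import Data.Sign.Base as Sign
open import Data.Sum.Base using (inj₁; inj₂; [_,_]′)
open import Data.Unit.Base using (⊤)
open import Data.Vec.Base using (Vec; []; _∷_; lookup; tabulate)
open import Data.Vec.Properties using (tabulate-cong; tabulate∘lookup)
open import Data.Vec.Relation.Binary.Pointwise.Inductive using ([]; _∷_)
open import Data.Vec.Relation.Unary.All using ([]; _∷_)
open import Data.Vec.Relation.Unary.All.Properties using (tabulate⁺; lookup⁺)
open import Function.Base using (id; _∘_)
open import Level using (0ℓ)
open import Relation.Binary.PropositionalEquality using (_≡_; _≗_; refl; sym; trans; cong; cong₂; subst; subst₂; ≢-sym; module ≡-Reasoning)
open import Relation.Binary.Structures using (IsTotalOrder)
open import Relation.Nullary using (¬_; yes; no; contradiction)
open import Relation.Nullary.Decidable.Core using (dec⇒maybe)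

-- No Lipschitz bound on the gradient is available, so even a very short step may meet an arbitrary
-- change of `∇f`. The only control is that `∇f` is antitone on ordered points. The error of a
-- single step therefore need not be small; it is charged to the decrease of S, which is paid for
-- only once over the whole run.
--
-- The offset t₀ has three origins. A clock started at 0 admits no first step, since
-- `δ ≤ η * (0 + δ)` with η < 1 forces δ = 0; from t₀ on, the admissible steps grow with the clock,
-- so the number of phases is logarithmic in 1/t₀. The segments from 0 to x and from y to 1, both of
-- length t₀, are what concavity needs to bound t₀ S₀. Finally, the gradients at two ordered points
-- are compared by moving both points upwards by the same increment, and this takes room between y
-- and 1.
--
-- Concavity holds only along nonnegative directions. Hence every displacement that is neither a
-- rise nor a fall is split into a rise and a fall.

-- Ring solver with integer coefficients.

module IntegerRingSolver (R : CommutativeRing 0ℓ 0ℓ) where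

  open CommutativeRing R renaming (refl to ≈-refl; sym to ≈-sym; trans to ≈-trans)
  open RingProperties ring using (-0#≈0#; -‿distribˡ-*; -‿distribʳ-*; -‿involutive; -‿+-comm)
  open SemiringMult semiring using (×-homo-+; ×1-homo-*) renaming (_×_ to _·_)
  open SemiringMult′ semiring using (×ᵤ≈×) renaming (_×_ to _·′_)
  open import Relation.Binary.Reasoning.Setoid setoid

  -- With the optimised multiples the constants 0, 1 and 2 evaluate definitionally to `0#`, `1#` and
  -- `1# + 1#`, so that solved equations match goals about `2#` directly.
  ⟦_⟧ᶻ : ℤ → Carrier
  ⟦ + n ⟧ᶻ      = n ·′ 1#
  ⟦ -[1+ n ] ⟧ᶻ = - (suc n ·′ 1#)

  private
    ι : ℕ → Carrier
    ι n = n · 1#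

    ι⁺ : ∀ n → ⟦ + n ⟧ᶻ ≈ ι n
    ι⁺ n = ≈-sym (×ᵤ≈× n 1#)

    ι⁻ : ∀ n → ⟦ -[1+ n ] ⟧ᶻ ≈ - ι (suc n)
    ι⁻ n = -‿cong (≈-sym (×ᵤ≈× (suc n) 1#))

    cancel : ∀ x y z → y - z ≈ (x + y) - (x + z)
    cancel x y z = begin
      y - z                 ≈⟨ +-congʳ (+-identityˡ y) ⟨
      0# + y - z            ≈⟨ +-congʳ (+-congʳ (-‿inverseʳ x)) ⟨
      x - x + y - z         ≈⟨ +-congʳ (+-assoc x (- x) y) ⟩
      x + (- x + y) - z     ≈⟨ +-congʳ (+-congˡ (+-comm (- x) y)) ⟩
      x + (y - x) - z       ≈⟨ +-congʳ (+-assoc x y (- x)) ⟨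
      x + y - x - z         ≈⟨ +-assoc (x + y) (- x) (- z) ⟩
      x + y + (- x - z)     ≈⟨ +-congˡ (-‿+-comm x z) ⟩
      (x + y) - (x + z)     ∎

    ⟦⟧-⊖ : ∀ m n → ⟦ m ⊖ n ⟧ᶻ ≈ ι m - ι n
    ⟦⟧-⊖ zero    zero    = ≈-sym (-‿inverseʳ 0#)
    ⟦⟧-⊖ zero    (suc n) = ≈-trans (ι⁻ n) (≈-sym (+-identityˡ _))
    ⟦⟧-⊖ (suc m) zero    = ≈-trans (ι⁺ (suc m)) (≈-trans (≈-sym (+-identityʳ _)) (+-congˡ (≈-sym -0#≈0#)))
    ⟦⟧-⊖ (suc m) (suc n) = begin
      ⟦ suc m ⊖ suc n ⟧ᶻ  ≡⟨ cong ⟦_⟧ᶻ (ℤ.[1+m]⊖[1+n]≡m⊖n m n) ⟩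
      ⟦ m ⊖ n ⟧ᶻ          ≈⟨ ⟦⟧-⊖ m n ⟩
      ι m - ι n          ≈⟨ cancel 1# (ι m) (ι n) ⟩
      ι (suc m) - ι (suc n) ∎

    ⟦⟧-⁻◃ : ∀ n → ⟦ Sign.- ◃ n ⟧ᶻ ≈ - ι n
    ⟦⟧-⁻◃ zero    = ≈-sym -0#≈0#
    ⟦⟧-⁻◃ (suc n) = ι⁻ n

    ⟦⟧-⁺◃ : ∀ n → ⟦ Sign.+ ◃ n ⟧ᶻ ≈ ι n
    ⟦⟧-⁺◃ zero    = ≈-refl
    ⟦⟧-⁺◃ (suc n) = ι⁺ (suc n)

    +-homo : ∀ i j → ⟦ i ℤ.+ j ⟧ᶻ ≈ ⟦ i ⟧ᶻ + ⟦ j ⟧ᶻ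
    +-homo (+ m)    (+ n)    = ≈-trans (ι⁺ (m ℕ.+ n)) (≈-trans (×-homo-+ 1# m n) (≈-sym (+-cong (ι⁺ m) (ι⁺ n))))
    +-homo (+ m)    -[1+ n ] = ≈-trans (⟦⟧-⊖ m (suc n)) (≈-sym (+-cong (ι⁺ m) (ι⁻ n)))
    +-homo -[1+ m ] (+ n)    = ≈-trans (⟦⟧-⊖ n (suc m)) (≈-trans (+-comm _ _) (≈-sym (+-cong (ι⁻ m) (ι⁺ n))))
    +-homo -[1+ m ] -[1+ n ] = begin
      ⟦ -[1+ suc (m ℕ.+ n) ] ⟧ᶻ      ≈⟨ ι⁻ (suc (m ℕ.+ n)) ⟩
      - ι (suc (suc (m ℕ.+ n)))      ≡⟨ cong (λ k → - ι (suc k)) (+-suc m n) ⟨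
      - ι (suc m ℕ.+ suc n)          ≈⟨ -‿cong (×-homo-+ 1# (suc m) (suc n)) ⟩
      - (ι (suc m) + ι (suc n))      ≈⟨ -‿+-comm _ _ ⟨
      - ι (suc m) - ι (suc n)        ≈⟨ +-cong (ι⁻ m) (ι⁻ n) ⟨
      ⟦ -[1+ m ] ⟧ᶻ + ⟦ -[1+ n ] ⟧ᶻ  ∎

    *-homo : ∀ i j → ⟦ i ℤ.* j ⟧ᶻ ≈ ⟦ i ⟧ᶻ * ⟦ j ⟧ᶻ
    *-homo (+ m)    (+ n)    = begin
      ⟦ Sign.+ ◃ m ℕ.* n ⟧ᶻ  ≈⟨ ⟦⟧-⁺◃ (m ℕ.* n) ⟩
      ι (m ℕ.* n)            ≈⟨ ×1-homo-* m n ⟩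
      ι m * ι n              ≈⟨ *-cong (ι⁺ m) (ι⁺ n) ⟨
      ⟦ + m ⟧ᶻ * ⟦ + n ⟧ᶻ    ∎
    *-homo (+ m)    -[1+ n ] = begin
      ⟦ Sign.- ◃ m ℕ.* suc n ⟧ᶻ  ≈⟨ ⟦⟧-⁻◃ (m ℕ.* suc n) ⟩
      - ι (m ℕ.* suc n)          ≈⟨ -‿cong (×1-homo-* m (suc n)) ⟩
      - (ι m * ι (suc n))        ≈⟨ -‿distribʳ-* _ _ ⟩
      ι m * - ι (suc n)          ≈⟨ *-cong (ι⁺ m) (ι⁻ n) ⟨
      ⟦ + m ⟧ᶻ * ⟦ -[1+ n ] ⟧ᶻ   ∎
    *-homo -[1+ m ] (+ n)    = begin
      ⟦ Sign.- ◃ suc m ℕ.* n ⟧ᶻ  ≈⟨ ⟦⟧-⁻◃ (suc m ℕ.* n) ⟩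
      - ι (suc m ℕ.* n)          ≈⟨ -‿cong (×1-homo-* (suc m) n) ⟩
      - (ι (suc m) * ι n)        ≈⟨ -‿distribˡ-* _ _ ⟩
      - ι (suc m) * ι n          ≈⟨ *-cong (ι⁻ m) (ι⁺ n) ⟨
      ⟦ -[1+ m ] ⟧ᶻ * ⟦ + n ⟧ᶻ   ∎
    *-homo -[1+ m ] -[1+ n ] = begin
      ⟦ Sign.+ ◃ suc m ℕ.* suc n ⟧ᶻ  ≈⟨ ⟦⟧-⁺◃ (suc m ℕ.* suc n) ⟩
      ι (suc m ℕ.* suc n)            ≈⟨ ×1-homo-* (suc m) (suc n) ⟩
      ι (suc m) * ι (suc n)          ≈⟨ -‿involutive _ ⟨
      - - (ι (suc m) * ι (suc n))    ≈⟨ -‿cong (-‿distribʳ-* _ _) ⟩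
      - (ι (suc m) * - ι (suc n))    ≈⟨ -‿distribˡ-* _ _ ⟩
      - ι (suc m) * - ι (suc n)      ≈⟨ *-cong (ι⁻ m) (ι⁻ n) ⟨
      ⟦ -[1+ m ] ⟧ᶻ * ⟦ -[1+ n ] ⟧ᶻ  ∎

    -‿homo : ∀ i → ⟦ ℤ.- i ⟧ᶻ ≈ - ⟦ i ⟧ᶻ
    -‿homo (+ zero)  = ≈-sym -0#≈0#
    -‿homo (+ suc n) = ≈-refl
    -‿homo -[1+ n ]  = ≈-sym (-‿involutive _)

    morphism : Ring.rawRing ℤ.+-*-ring -Raw-AlmostCommutative⟶ fromCommutativeRing R
    morphism = record
      { ⟦_⟧ = ⟦_⟧ᶻ ; +-homo = +-homo ; *-homo = *-homo ; -‿homo = -‿homo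
      ; 0-homo = ≈-refl ; 1-homo = ≈-refl }

  open RingSolver (Ring.rawRing ℤ.+-*-ring) (fromCommutativeRing R) morphism
    (λ i j → Maybe.map (λ i≡j → reflexive (cong ⟦_⟧ᶻ i≡j)) (dec⇒maybe (i ℤ.≟ j))) public
    using (Polynomial; solve; con; _:=_; _:+_; _:*_; _:-_; :-_)

  :0 :1 :2 : ∀ {n} → Polynomial n
  :0 = con (+ 0)
  :1 = con (+ 1)
  :2 = con (+ 2)

-- Ordered-field inequalities, powers of two and logarithms.

module OrderedField (em : ExcludedMiddle 0ℓ) (𝓡 : CompleteOrderedField) where

  open DRSubmodularMaximization 𝓡
  open IsTotalOrder isTotalOrder public using (total; antisym)
    renaming (refl to ≤-refl; trans to ≤-trans; reflexive to ≤-reflexive)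
  open IntegerRingSolver commutativeRing public
  open CommutativeRing commutativeRing public
    using (semiring; +-identityʳ; +-identityˡ; *-identityˡ; *-identityʳ; *-comm; +-comm; *-assoc; -‿inverseʳ; zeroʳ)
  open SemiringMult semiring public using (×-homo-+; ×1-homo-*)
  open SemiringExp semiring public using (^-homo-*; ^-assocʳ)
  open Max totalOrder using (x≤y⇒y⊔x≈y; x≤y⇒x⊔y≈y; x≤x⊔y; x≤y⊔x)

  infixl 6 _⊞_
  infixl 7 _⊠_

  _⊞_ : ∀ {x y} → 0# ≤ x → 0# ≤ y → 0# ≤ x + y
  _⊞_ {x} {y} 0≤x 0≤y = ≤-trans 0≤y (subst (_≤ x + y) (+-identityˡ y) (+-mono-≤ y 0≤x))

  _⊠_ : ∀ {x y} → 0# ≤ x → 0# ≤ y → 0# ≤ x * y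
  _⊠_ = *-nonNegative

  gap : ∀ {x y} → x ≤ y → 0# ≤ y - x
  gap {x} {y} x≤y = subst (_≤ y - x) (-‿inverseʳ x) (+-mono-≤ (- x) x≤y)

  -- An inequality x ≤ y is proved by exhibiting y - x as a combination c of
  -- quantities known to be nonnegative.
  by : ∀ {x y c} → 0# ≤ c → y ≡ x + c → x ≤ y
  by {x} {y} {c} 0≤c eq = subst (x ≤_) (trans (+-comm c x) (sym eq))
    (subst (_≤ c + x) (+-identityˡ x) (+-mono-≤ x 0≤c))

  0≤neg : ∀ {x} → x ≤ 0# → 0# ≤ - x
  0≤neg {x} x≤0 = by (gap x≤0) (solve 1 (λ x → :- x := :0 :+ (:0 :- x)) refl x)

  0≤x² : ∀ x → 0# ≤ x * x
  0≤x² x with total 0# x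
  ... | inj₁ 0≤x = 0≤x ⊠ 0≤x
  ... | inj₂ x≤0 = by (0≤neg x≤0 ⊠ 0≤neg x≤0)
    (solve 1 (λ x → x :* x := :0 :+ (:- x) :* (:- x)) refl x)

  0≤1 : 0# ≤ 1#
  0≤1 = subst (0# ≤_) (*-identityˡ 1#) (0≤x² 1#)

  0≤2 : 0# ≤ 2#
  0≤2 = 0≤1 ⊞ 0≤1

  0≤fromℕ : ∀ k → 0# ≤ fromℕ k
  0≤fromℕ zero    = ≤-refl
  0≤fromℕ (suc k) = 0≤1 ⊞ 0≤fromℕ k

  ≰⇒≥ : ∀ {x y} → ¬ x ≤ y → y ≤ x
  ≰⇒≥ {x} {y} x≰y = [ (λ x≤y → contradiction x≤y x≰y) , id ]′ (total x y)

  ≰⇒> : ∀ {x y} → ¬ x ≤ y → y < x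
  ≰⇒> x≰y = ≰⇒≥ x≰y , λ { refl → x≰y ≤-refl }

  <⇒≱ : ∀ {x y} → x < y → ¬ y ≤ x
  <⇒≱ (x≤y , x≢y) y≤x = x≢y (antisym x≤y y≤x)

  <-≤-trans : ∀ {x y z} → x < y → y ≤ z → x < z
  <-≤-trans x<y@(x≤y , _) y≤z = ≤-trans x≤y y≤z , λ { refl → <⇒≱ x<y y≤z }

  x<x+1 : ∀ x → x < x + 1#
  x<x+1 x = by 0≤1 refl , λ x≡x+1 → 0≢1 (begin
    0#          ≡⟨ -‿inverseʳ x ⟨
    x - x       ≡⟨ cong (_- x) x≡x+1 ⟩
    x + 1# - x  ≡⟨ solve 1 (λ x → x :+ :1 :- x := :1) refl x ⟩
    1#          ∎)
    where open ≡-Reasoning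

  0<1 : 0# < 1#
  0<1 = 0≤1 , 0≢1

  0<2 : 0# < 2#
  0<2 = <-≤-trans 0<1 (by 0≤1 refl)

  gap-< : ∀ {x y} → x < y → 0# < y - x
  gap-< {x} {y} (x≤y , x≢y) = gap x≤y , λ 0≡y-x → x≢y (begin
    x            ≡⟨ +-identityˡ x ⟨
    0# + x       ≡⟨ cong (_+ x) 0≡y-x ⟩
    y - x + x    ≡⟨ solve 2 (λ x y → y :- x :+ x := y) refl x y ⟩
    y            ∎)
    where open ≡-Reasoning

  *⁻¹ : ∀ {x} → 0# < x → x * x ⁻¹ ≡ 1#
  *⁻¹ (_ , 0≢x) = ⁻¹-inverse _ (≢-sym 0≢x)

  0≤⁻¹ : ∀ {x} → 0# < x → 0# ≤ x ⁻¹
  0≤⁻¹ {x} 0<x with total 0# (x ⁻¹)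
  ... | inj₁ p = p
  ... | inj₂ q = contradiction
    (by (proj₁ 0<x ⊠ 0≤neg q)
      (trans (solve 2 (λ x y → :0 := x :* y :+ x :* (:- y)) refl x (x ⁻¹))
             (cong (_+ x * - (x ⁻¹)) (*⁻¹ 0<x))))
    (<⇒≱ 0<1)

  0<⁻¹ : ∀ {x} → 0# < x → 0# < x ⁻¹
  0<⁻¹ {x} 0<x = 0≤⁻¹ 0<x , λ 0≡x⁻¹ → 0≢1 (begin
    0#        ≡⟨ zeroʳ x ⟨
    x * 0#    ≡⟨ cong (x *_) 0≡x⁻¹ ⟩
    x * x ⁻¹  ≡⟨ *⁻¹ 0<x ⟩
    1#        ∎)
    where open ≡-Reasoning

  *-mono-≤ : ∀ {x y z} → 0# ≤ z → x ≤ y → z * x ≤ z * y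
  *-mono-≤ {x} {y} {z} 0≤z x≤y = by (0≤z ⊠ gap x≤y)
    (solve 3 (λ x y z → z :* y := z :* x :+ z :* (y :- x)) refl x y z)

  *-cancel-≤ : ∀ {x y z} → 0# < z → z * x ≤ z * y → x ≤ y
  *-cancel-≤ {x} {y} {z} 0<z zx≤zy =
    subst₂ _≤_ (unscale x) (unscale y) (*-mono-≤ (0≤⁻¹ 0<z) zx≤zy)
    where
    open ≡-Reasoning
    unscale : ∀ x → z ⁻¹ * (z * x) ≡ x
    unscale x = begin
      z ⁻¹ * (z * x)  ≡⟨ solve 3 (λ i z x → i :* (z :* x) := z :* i :* x) refl (z ⁻¹) z x ⟩
      z * z ⁻¹ * x    ≡⟨ cong (_* x) (*⁻¹ 0<z) ⟩
      1# * x          ≡⟨ *-identityˡ x ⟩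
      x               ∎

  0<* : ∀ {x y} → 0# < x → 0# < y → 0# < x * y
  0<* {x} {y} 0<x 0<y = ≰⇒> λ xy≤0 → <⇒≱ 0<y (*-cancel-≤ 0<x (subst (x * y ≤_) (sym (zeroʳ x)) xy≤0))

  2*½ : 2# * ½ ≡ 1#
  2*½ = *⁻¹ 0<2

  ∣∣-nonneg : ∀ {x} → 0# ≤ x → ∣ x ∣ ≡ x
  ∣∣-nonneg {x} 0≤x = x≤y⇒y⊔x≈y
    (by (0≤x ⊞ 0≤x) (solve 1 (λ x → x := :- x :+ (x :+ x)) refl x))

  ∣∣-nonpos : ∀ {x} → x ≤ 0# → ∣ x ∣ ≡ - x
  ∣∣-nonpos {x} x≤0 = x≤y⇒x⊔y≈y
    (by (0≤neg x≤0 ⊞ 0≤neg x≤0) (solve 1 (λ x → :- x := x :+ (:- x :+ :- x)) refl x))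

  x≤∣x∣ : ∀ x → x ≤ ∣ x ∣
  x≤∣x∣ x = x≤x⊔y x (- x)

  -x≤∣x∣ : ∀ x → - x ≤ ∣ x ∣
  -x≤∣x∣ x = x≤y⊔x x (- x)

  0≤∣x∣ : ∀ x → 0# ≤ ∣ x ∣
  0≤∣x∣ x with total 0# x
  ... | inj₁ 0≤x = ≤-trans 0≤x (x≤∣x∣ x)
  ... | inj₂ x≤0 = ≤-trans (0≤neg x≤0) (-x≤∣x∣ x)

  ∣∣-scale : ∀ {s} → 0# ≤ s → ∀ x → ∣ s * x ∣ ≡ s * ∣ x ∣
  ∣∣-scale {s} 0≤s x with total 0# x
  ... | inj₁ 0≤x = trans (∣∣-nonneg (0≤s ⊠ 0≤x)) (cong (s *_) (sym (∣∣-nonneg 0≤x)))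
  ... | inj₂ x≤0 = begin
    ∣ s * x ∣  ≡⟨ ∣∣-nonpos (by (0≤s ⊠ 0≤neg x≤0) (solve 2 (λ s x → :0 := s :* x :+ s :* (:- x)) refl s x)) ⟩
    - (s * x)  ≡⟨ solve 2 (λ s x → :- (s :* x) := s :* (:- x)) refl s x ⟩
    s * - x    ≡⟨ cong (s *_) (∣∣-nonpos x≤0) ⟨
    s * ∣ x ∣  ∎
    where open ≡-Reasoning

  -- Archimedean property and powers of two

  archimedean : ∀ x → ∃[ k ] x ≤ fromℕ k
  archimedean x with em {∃[ k ] x ≤ fromℕ k}
  ... | yes p = p
  ... | no ¬p = contradiction (least (s - 1#) bound) (<⇒≱ s-1<s)
    where
    isSup : ∃ (IsSupremum _≤_ (λ y → ∃[ k ] y ≡ fromℕ k))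
    isSup = complete _ (0# , 0 , refl) (x , λ { _ (k , refl) → ≰⇒≥ (λ x≤k → ¬p (k , x≤k)) })
    s     = proj₁ isSup
    upper = proj₁ (proj₂ isSup)
    least = proj₂ (proj₂ isSup)
    bound : ∀ y → (∃[ k ] y ≡ fromℕ k) → y ≤ s - 1#
    bound _ (k , refl) = by (gap (upper _ (suc k , refl)))
      (solve 2 (λ s k → s :- :1 := k :+ (s :- (:1 :+ k))) refl s (fromℕ k))
    s-1<s : s - 1# < s
    s-1<s = subst (s - 1# <_) (solve 1 (λ s → s :- :1 :+ :1 := s) refl s) (x<x+1 (s - 1#))

  -- The search descends from the given witness and stops at the first failure. Excluding the
  -- immediate predecessor is what rounding to within one unit requires.
  leastℕ : (P : ℕ → Set) → ∀ k → P k → ∃[ j ] P j × (∀ i → j ≡ suc i → ¬ P i)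
  leastℕ P zero    p = 0 , p , λ _ ()
  leastℕ P (suc k) p with em {P k}
  ... | yes q = leastℕ P k q
  ... | no ¬q = suc k , p , λ { _ refl → ¬q }

  1≤2^ : ∀ k → 1# ≤ 2# ^ k
  1≤2^ zero    = ≤-refl
  1≤2^ (suc k) = by (0≤1 ⊞ gap (1≤2^ k) ⊞ gap (1≤2^ k))
    (solve 1 (λ p → :2 :* p := :1 :+ (:1 :+ (p :- :1) :+ (p :- :1))) refl (2# ^ k))

  0≤2^ : ∀ k → 0# ≤ 2# ^ k
  0≤2^ k = ≤-trans 0≤1 (1≤2^ k)

  fromℕ≤2^ : ∀ k → fromℕ k ≤ 2# ^ k
  fromℕ≤2^ zero    = 0≤1
  fromℕ≤2^ (suc k) = by (gap (1≤2^ k) ⊞ gap (fromℕ≤2^ k))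
    (solve 2 (λ p k → :2 :* p := :1 :+ k :+ ((p :- :1) :+ (p :- k))) refl (2# ^ k) (fromℕ k))

  2^-unbounded : ∀ x → ∃[ k ] x ≤ 2# ^ k
  2^-unbounded x with archimedean x
  ... | k , x≤k = k , ≤-trans x≤k (fromℕ≤2^ k)

  2^*½^ : ∀ k → 2# ^ k * ½ ^ k ≡ 1#
  2^*½^ zero    = *-identityˡ 1#
  2^*½^ (suc k) = begin
    2# * 2# ^ k * (½ * ½ ^ k)    ≡⟨ solve 4 (λ a b c d → a :* b :* (c :* d) := a :* c :* (b :* d)) refl 2# (2# ^ k) ½ (½ ^ k) ⟩
    2# * ½ * (2# ^ k * ½ ^ k)    ≡⟨ cong₂ _*_ 2*½ (2^*½^ k) ⟩
    1# * 1#                      ≡⟨ *-identityˡ 1# ⟩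
    1#                           ∎
    where open ≡-Reasoning

  0<½^ : ∀ k → 0# < ½ ^ k
  0<½^ zero    = 0<1
  0<½^ (suc k) = 0<* (0<⁻¹ 0<2) (0<½^ k)

  ½^≤1 : ∀ k → ½ ^ k ≤ 1#
  ½^≤1 k = by (gap (1≤2^ k) ⊠ proj₁ (0<½^ k))
    (trans (sym (2^*½^ k)) (solve 2 (λ p s → p :* s := s :+ (p :- :1) :* s) refl (2# ^ k) (½ ^ k)))

  halve-sum : ∀ s x → ½ * s * x + ½ * s * x ≡ s * x
  halve-sum s x = begin
    ½ * s * x + ½ * s * x  ≡⟨ solve 3 (λ h s x → h :* s :* x :+ h :* s :* x := :2 :* h :* (s :* x)) refl ½ s x ⟩
    2# * ½ * (s * x)       ≡⟨ cong (_* (s * x)) 2*½ ⟩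
    1# * (s * x)           ≡⟨ *-identityˡ (s * x) ⟩
    s * x                  ∎
    where open ≡-Reasoning

  rescale : ∀ k {g t} → g ≤ ½ ^ k * t → 2# ^ k * g ≤ t
  rescale k {g} {t} g≤st = subst (2# ^ k * g ≤_) (begin
    2# ^ k * (½ ^ k * t)  ≡⟨ *-assoc (2# ^ k) (½ ^ k) t ⟨
    2# ^ k * ½ ^ k * t    ≡⟨ cong (_* t) (2^*½^ k) ⟩
    1# * t                ≡⟨ *-identityˡ t ⟩
    t                     ∎) (*-mono-≤ (0≤2^ k) g≤st)
    where open ≡-Reasoning

  2^-cancel-≤ : ∀ a c → 2# ^ a ≤ 2# ^ c → a ℕ.≤ c
  2^-cancel-≤ zero    c       _ = z≤n
  2^-cancel-≤ (suc a) zero    p = contradiction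
    (by (gap p ⊞ gap (1≤2^ a) ⊞ gap (1≤2^ a))
      (solve 1 (λ q → :0 := :1 :+ (:1 :- :2 :* q :+ (q :- :1) :+ (q :- :1))) refl (2# ^ a)))
    (<⇒≱ 0<1)
  2^-cancel-≤ (suc a) (suc c) p = s≤s (2^-cancel-≤ a c (*-cancel-≤ 0<2 p))

  fromℕ-mono : ∀ {a b} → a ℕ.≤ b → fromℕ a ≤ fromℕ b
  fromℕ-mono {b = b} z≤n = 0≤fromℕ b
  fromℕ-mono (s≤s {m} {n} a≤b) = by (gap (fromℕ-mono a≤b))
    (solve 2 (λ m n → :1 :+ n := :1 :+ m :+ (n :- m)) refl (fromℕ m) (fromℕ n))

  ^-mono-≤ : ∀ {x y} → 0# ≤ x → x ≤ y → ∀ k → x ^ k ≤ y ^ k × 0# ≤ x ^ k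
  ^-mono-≤ 0≤x x≤y zero = ≤-refl , 0≤1
  ^-mono-≤ {x} {y} 0≤x x≤y (suc k) with ^-mono-≤ 0≤x x≤y k
  ... | xᵏ≤yᵏ , 0≤xᵏ =
    by (≤-trans 0≤x x≤y ⊠ gap xᵏ≤yᵏ ⊞ gap x≤y ⊠ 0≤xᵏ)
      (solve 4 (λ x y p q → y :* q := x :* p :+ (y :* (q :- p) :+ (y :- x) :* p)) refl x y (x ^ k) (y ^ k)) ,
    0≤x ⊠ 0≤xᵏ

  -- Binary logarithms

  IsLog₂-≥ : ∀ {x ℓ} k → IsLog₂ x ℓ → 2# ^ k ≤ x → fromℕ k ≤ ℓ
  IsLog₂-≥ {x} k (upper , _) 2ᵏ≤x = upper (fromℕ k)
    (k , 0 , 0 , solve 1 (λ k → (:1 :+ :0) :* k := k :- :0) refl (fromℕ k) ,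
     subst (2# ^ k ≤_) (solve 1 (λ x → x := :1 :* (x :* :1)) refl x) 2ᵏ≤x)

  -- Completeness applies because 0 belongs to the set and any J with `x ≤ 2# ^ J` bounds it:
  -- comparing exponents in 2ᵃ ≤ 2ᵇ x^q ≤ 2^(b + J q) gives a - b ≤ J q.
  IsLog₂-exists : ∀ x → 1# ≤ x → ∃ (IsLog₂ x)
  IsLog₂-exists x 1≤x with 2^-unbounded x
  ... | J , x≤2ᴶ = complete _
    (0# , 0 , 0 , 0 , solve 0 ((:1 :+ :0) :* :0 := :0 :- :0) refl ,
      subst (1# ≤_) (solve 1 (λ x → x := :1 :* (x :* :1)) refl x) 1≤x)
    (fromℕ J , bound)
    where
    bound : ∀ r → _ → r ≤ fromℕ J
    bound r (a , b , k , qr≡a-b , 2ᵃ≤2ᵇx^q) = *-cancel-≤ 0<q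
      (subst₂ _≤_ (sym qr≡a-b) refl
        (by (gap a≤b+Jq)
          (trans (solve 4 (λ a b q J → q :* J := a :- b :+ (b :+ J :* q :- a)) refl (fromℕ a) (fromℕ b) (fromℕ q) (fromℕ J))
            (cong (λ e → fromℕ a - fromℕ b + (e - fromℕ a))
              (sym (trans (×-homo-+ 1# b (J ℕ.* q)) (cong (λ e → fromℕ b + e) (×1-homo-* J q))))))))
      where
      q = suc k
      0<q : 0# < fromℕ q
      0<q = <-≤-trans 0<1 (by (0≤fromℕ k) refl)
      pow : 2# ^ b * (2# ^ J) ^ q ≡ 2# ^ (b ℕ.+ J ℕ.* q)
      pow = trans (cong (2# ^ b *_) (^-assocʳ 2# J q)) (sym (^-homo-* 2# b (J ℕ.* q)))
      a≤b+Jq : fromℕ a ≤ fromℕ (b ℕ.+ J ℕ.* q)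
      a≤b+Jq = fromℕ-mono (2^-cancel-≤ a (b ℕ.+ J ℕ.* q) (≤-trans 2ᵃ≤2ᵇx^q
        (subst (2# ^ b * x ^ q ≤_) pow
          (*-mono-≤ (0≤2^ b) (proj₁ (^-mono-≤ (≤-trans 0≤1 1≤x) x≤2ᴶ q))))))

-- Points as functions, and diminishing returns along nonnegative directions.

module Points (em : ExcludedMiddle 0ℓ) (𝓡 : CompleteOrderedField) where

  open DRSubmodularMaximization 𝓡
  open OrderedField em 𝓡
  open SemiringSum semiring public using (sum; sum-cong-≗; ∑-distrib-+; *-distribˡ-sum)

  -- Sequences Fin n → ℝ, rather than the vectors of the statement, serve as points.
  Point : ℕ → Set
  Point n = Fin n → ℝ

  infix 9 _∙_

  _∙_ : ∀ {n} → Point n → Point n → ℝ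
  u ∙ v = sum (λ i → u i * v i)

  sum-mono-≤ : ∀ {n} {u v : Point n} → (∀ i → u i ≤ v i) → sum u ≤ sum v
  sum-mono-≤ {zero}          u≤v = ≤-refl
  sum-mono-≤ {suc n} {u} {v} u≤v = by (gap (u≤v zero) ⊞ gap (sum-mono-≤ (u≤v ∘ suc)))
    (solve 4 (λ a b c d → b :+ d := a :+ c :+ ((b :- a) :+ (d :- c))) refl
      (u zero) (v zero) (sum (u ∘ suc)) (sum (v ∘ suc)))

  sum-zero : ∀ {n} {u : Point n} → (∀ i → u i ≡ 0#) → sum u ≡ 0#
  sum-zero {zero}  u≡0 = refl
  sum-zero {suc n} u≡0 = trans (cong₂ _+_ (u≡0 zero) (sum-zero (u≡0 ∘ suc))) (+-identityʳ 0#)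

  0≤sum : ∀ {n} {u : Point n} → (∀ i → 0# ≤ u i) → 0# ≤ sum u
  0≤sum {n} {u} 0≤u = subst (_≤ sum u) (sum-zero {n} (λ _ → refl)) (sum-mono-≤ 0≤u)

  ∙-scaleʳ : ∀ {n} s (u v : Point n) → u ∙ (λ i → s * v i) ≡ s * u ∙ v
  ∙-scaleʳ s u v = trans
    (sum-cong-≗ (λ i → solve 3 (λ s u v → u :* (s :* v) := s :* (u :* v)) refl s (u i) (v i)))
    (sym (*-distribˡ-sum s (λ i → u i * v i)))

  sum-linear : ∀ {n} α β (u v : Point n) → sum (λ i → α * u i + β * v i) ≡ α * sum u + β * sum v
  sum-linear α β u v = trans (∑-distrib-+ (λ i → α * u i) (λ i → β * v i))
    (cong₂ _+_ (sym (*-distribˡ-sum α u)) (sym (*-distribˡ-sum β v)))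

  ∙-monoˡ-≤ : ∀ {n} {u w v : Point n} → (∀ i → 0# ≤ v i) → (∀ i → u i ≤ w i) → u ∙ v ≤ w ∙ v
  ∙-monoˡ-≤ {u = u} {w} {v} 0≤v u≤w = sum-mono-≤ λ i →
    subst₂ _≤_ (*-comm (v i) (u i)) (*-comm (v i) (w i)) (*-mono-≤ (0≤v i) (u≤w i))

  -- The test vectors are kept below ρ because they will be increments that must not leave the cube;
  -- ρ times a basis vector isolates one coordinate.
  ∙-reflects-≤ : ∀ {n} {u w : Point n} {ρ} → 0# < ρ →
    (∀ v → (∀ i → 0# ≤ v i × v i ≤ ρ) → u ∙ v ≤ w ∙ v) → ∀ i → u i ≤ w i
  ∙-reflects-≤ {suc n} {u} {w} {ρ} 0<ρ u≤w zero = *-cancel-≤ 0<ρ (subst₂ _≤_ (first u) (first w) (u≤w e bounds))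
    where
    e : Point (suc n)
    e zero    = ρ
    e (suc _) = 0#
    bounds : ∀ i → 0# ≤ e i × e i ≤ ρ
    bounds zero    = proj₁ 0<ρ , ≤-refl
    bounds (suc _) = ≤-refl , proj₁ 0<ρ
    first : ∀ x → x ∙ e ≡ ρ * x zero
    first x = trans (cong (λ y → x zero * ρ + y) (sum-zero (λ i → zeroʳ (x (suc i)))))
      (solve 2 (λ x ρ → x :* ρ :+ :0 := ρ :* x) refl (x zero) ρ)
  ∙-reflects-≤ {suc n} {u} {w} {ρ} 0<ρ u≤w (suc i) = ∙-reflects-≤ 0<ρ
    (λ v bounds → subst₂ _≤_ (rest u v) (rest w v)
      (u≤w (extend v) (λ { zero → ≤-refl , proj₁ 0<ρ ; (suc j) → bounds j }))) i
    where
    extend : Point n → Point (suc n)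
    extend v zero    = 0#
    extend v (suc j) = v j
    rest : ∀ x v → x ∙ extend v ≡ (x ∘ suc) ∙ v
    rest x v = solve 2 (λ x y → x :* :0 :+ y := y) refl (x zero) ((x ∘ suc) ∙ v)

  ∥_∥ : ∀ {n} → Point n → ℝ
  ∥ v ∥ = sum (λ i → ∣ v i ∣)

  0≤∥∥ : ∀ {n} (v : Point n) → 0# ≤ ∥ v ∥
  0≤∥∥ v = 0≤sum (λ i → 0≤∣x∣ (v i))

  ‖‖₁-tabulate : ∀ {n} (x y : Point n) → ‖ tabulate y -ᵛ tabulate x ‖₁ ≡ sum (λ i → ∣ y i - x i ∣)
  ‖‖₁-tabulate {zero}  x y = refl
  ‖‖₁-tabulate {suc n} x y = cong (λ s → ∣ y zero - x zero ∣ + s) (‖‖₁-tabulate (x ∘ suc) (y ∘ suc))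

  ⟨⟩-tabulate : ∀ {n} (g : Vec ℝ n) (x y : Point n) →
    ⟨ g , tabulate y -ᵛ tabulate x ⟩ ≡ lookup g ∙ (λ i → y i - x i)
  ⟨⟩-tabulate []      x y = refl
  ⟨⟩-tabulate (a ∷ g) x y = cong (λ s → a * (y zero - x zero) + s) (⟨⟩-tabulate g (x ∘ suc) (y ∘ suc))

  Unit : ∀ {n} → Point n → Set
  Unit x = ∀ i → 0# ≤ x i × x i ≤ 1#

  inCube : ∀ {n} {x : Point n} → Unit x → InCube (tabulate x)
  inCube = tabulate⁺

  -- Strengthening diminishing returns to two functions makes the induction on
  -- the number of coordinates go through: fixing the first coordinate of x and
  -- of y to different values yields different functions.
  CrossDR : ∀ {n} → (g h : Vec ℝ n → ℝ) → Set
  CrossDR g h = ∀ x y → InCube x → InCube y → x ≤ᵛ y →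
    ∀ i δ → 0# ≤ δ → δ ≤ 1# → InCube (x ⊕ δ 𝟙⟨ i ⟩) → InCube (y ⊕ δ 𝟙⟨ i ⟩) →
    h (y ⊕ δ 𝟙⟨ i ⟩) - h y ≤ g (x ⊕ δ 𝟙⟨ i ⟩) - g x

  crossDR-increment : ∀ {n} {g h : Vec ℝ n → ℝ} → CrossDR g h → (x y v : Point n) →
    (∀ i → 0# ≤ x i) → (∀ i → x i ≤ y i) → (∀ i → 0# ≤ v i) → (∀ i → y i + v i ≤ 1#) →
    h (tabulate (λ i → y i + v i)) - h (tabulate y) ≤ g (tabulate (λ i → x i + v i)) - g (tabulate x)
  crossDR-increment {zero} {g} {h} dr x y v _ _ _ _ = ≤-reflexive
    (trans (-‿inverseʳ (h [])) (sym (-‿inverseʳ (g []))))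
  crossDR-increment {suc n} {g} {h} dr x y v 0≤x x≤y 0≤v y+v≤1 =
    by (gap first ⊞ gap rest)
      (solve 6 (λ p q r a b c → c :- a := r :- p :+ (b :- a :- (q :- p) :+ (c :- b :- (r :- q)))) refl
        (h (tabulate y)) (h (b′ ∷ tabulate (y ∘ suc))) (h (tabulate (λ i → y i + v i)))
        (g (tabulate x)) (g (a′ ∷ tabulate (x ∘ suc))) (g (tabulate (λ i → x i + v i))))
    where
    a′ = x zero + v zero
    b′ = y zero + v zero
    x+v≤1 : ∀ i → x i + v i ≤ 1#
    x+v≤1 i = ≤-trans (+-mono-≤ (v i) (x≤y i)) (y+v≤1 i)
    x∈ : Unit x
    x∈ i = 0≤x i , ≤-trans (by (0≤v i) refl) (x+v≤1 i)
    y∈ : Unit y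
    y∈ i = ≤-trans (0≤x i) (x≤y i) , ≤-trans (by (0≤v i) refl) (y+v≤1 i)
    a′∈ : 0# ≤ a′ × a′ ≤ 1#
    a′∈ = 0≤x zero ⊞ 0≤v zero , x+v≤1 zero
    b′∈ : 0# ≤ b′ × b′ ≤ 1#
    b′∈ = proj₁ (y∈ zero) ⊞ 0≤v zero , y+v≤1 zero
    ≤ᵛ-tabulate : ∀ {m} {x y : Point m} → (∀ i → x i ≤ y i) → tabulate x ≤ᵛ tabulate y
    ≤ᵛ-tabulate {zero}  _   = []
    ≤ᵛ-tabulate {suc m} x≤y = x≤y zero ∷ ≤ᵛ-tabulate (x≤y ∘ suc)
    first : h (b′ ∷ tabulate (y ∘ suc)) - h (tabulate y) ≤ g (a′ ∷ tabulate (x ∘ suc)) - g (tabulate x)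
    first = dr (tabulate x) (tabulate y) (inCube x∈) (inCube y∈) (≤ᵛ-tabulate x≤y) zero (v zero)
      (0≤v zero)
      (≤-trans (by (proj₁ (y∈ zero)) (+-comm (y zero) (v zero))) (y+v≤1 zero))
      (a′∈ ∷ inCube (x∈ ∘ suc)) (b′∈ ∷ inCube (y∈ ∘ suc))
    rest : h (tabulate (λ i → y i + v i)) - h (b′ ∷ tabulate (y ∘ suc)) ≤
           g (tabulate (λ i → x i + v i)) - g (a′ ∷ tabulate (x ∘ suc))
    rest = crossDR-increment {n} {λ z → g (a′ ∷ z)} {λ z → h (b′ ∷ z)}
      (λ X Y X∈ Y∈ X≤Y i δ 0≤δ δ≤1 X′∈ Y′∈ → dr (a′ ∷ X) (b′ ∷ Y) (a′∈ ∷ X∈) (b′∈ ∷ Y∈)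
        (+-mono-≤ (v zero) (x≤y zero) ∷ X≤Y) (suc i) δ 0≤δ δ≤1 (a′∈ ∷ X′∈) (b′∈ ∷ Y′∈))
      (x ∘ suc) (y ∘ suc) (v ∘ suc) (0≤x ∘ suc) (x≤y ∘ suc) (0≤v ∘ suc) (y+v≤1 ∘ suc)

  ≤-limit : ∀ {A B V} → 0# ≤ V → (∀ η → 0# < η → A ≤ B + η * V) → A ≤ B
  ≤-limit {A} {B} {V} 0≤V close with em {A ≤ B}
  ... | yes A≤B = A≤B
  ... | no  A≰B = contradiction (by (gap (close η 0<η)) 0≡) (<⇒≱ 0<η)
    where
    open ≡-Reasoning
    0<V+1 : 0# < V + 1#
    0<V+1 = <-≤-trans 0<1 (by 0≤V (+-comm V 1#))
    i = (V + 1#) ⁻¹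
    -- This choice makes `B + η * V` equal to `A - η`, which `close` contradicts.
    η = (A - B) * i
    0<η : 0# < η
    0<η = 0<* (gap-< (≰⇒> A≰B)) (0<⁻¹ 0<V+1)
    0≡ : 0# ≡ η + (B + η * V - A)
    0≡ = begin
      0#                                   ≡⟨ solve 2 (λ A B → :0 := (A :- B) :* :1 :- (A :- B)) refl A B ⟩
      (A - B) * 1# - (A - B)               ≡⟨ cong (λ c → (A - B) * c - (A - B)) (*⁻¹ 0<V+1) ⟨
      (A - B) * ((V + 1#) * i) - (A - B)   ≡⟨ solve 4 (λ A B V i → (A :- B) :* ((V :+ :1) :* i) :- (A :- B) :=
                                                (A :- B) :* i :+ (B :+ (A :- B) :* i :* V :- A)) refl A B V i ⟩
      η + (B + η * V - A)                  ∎

-- First-order calculus of DR-submodular functions.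

module DRCalculus (em : ExcludedMiddle 0ℓ) (𝓡 : CompleteOrderedField)
  {n : ℕ} (f : Vec (CompleteOrderedField.Carrier 𝓡) n → CompleteOrderedField.Carrier 𝓡)
  (∇f : Vec (CompleteOrderedField.Carrier 𝓡) n → Vec (CompleteOrderedField.Carrier 𝓡) n)
  (dr : DRSubmodularMaximization.DRSubmodular 𝓡 f)
  (grad : DRSubmodularMaximization.IsGradient 𝓡 f ∇f) where

  open DRSubmodularMaximization 𝓡
  open OrderedField em 𝓡
  open Points em 𝓡

  F : Point n → ℝ
  F x = f (tabulate x)

  ∇F : Point n → Point n
  ∇F x = lookup (∇f (tabulate x))

  F-cong : ∀ {x y} → x ≗ y → F x ≡ F y
  F-cong x≗y = cong f (tabulate-cong x≗y)

  ∇F-cong : ∀ {x y} → x ≗ y → ∇F x ≗ ∇F y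
  ∇F-cong x≗y i = cong (λ z → lookup (∇f z) i) (tabulate-cong x≗y)

  F-increment : (x y v : Point n) →
    (∀ i → 0# ≤ x i) → (∀ i → x i ≤ y i) → (∀ i → 0# ≤ v i) → (∀ i → y i + v i ≤ 1#) →
    F (λ i → y i + v i) - F y ≤ F (λ i → x i + v i) - F x
  F-increment = crossDR-increment dr

  segment∈ : ∀ {x v : Point n} {s} → 0# ≤ s → s ≤ 1# → Unit x → Unit (λ i → x i + v i) →
    Unit (λ i → x i + s * v i)
  segment∈ {x} {v} {s} 0≤s s≤1 x∈ y∈ i =
    by (gap s≤1 ⊠ proj₁ (x∈ i) ⊞ 0≤s ⊠ proj₁ (y∈ i))
      (solve 3 (λ x v s → x :+ s :* v := :0 :+ ((:1 :- s) :* x :+ s :* (x :+ v))) refl (x i) (v i) s) ,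
    by (gap s≤1 ⊠ gap (proj₂ (x∈ i)) ⊞ 0≤s ⊠ gap (proj₂ (y∈ i)))
      (solve 3 (λ x v s → :1 := x :+ s :* v :+ ((:1 :- s) :* (:1 :- x) :+ s :* (:1 :- (x :+ v)))) refl (x i) (v i) s)

  -- Differentiability enters the proof only here. Dyadic lengths fit the repeated halving of
  -- segments, and `v` may have any signs, so that a segment can be approached from its upper end
  -- too.
  first-order : ∀ x v → Unit x → Unit (λ i → x i + v i) → ∀ η → 0# < η → ∃[ k ]
    F (λ i → x i + ½ ^ k * v i) - F x ≤ ½ ^ k * (∇F x ∙ v + η * ∥ v ∥) ×
    ½ ^ k * (∇F x ∙ v - η * ∥ v ∥) ≤ F (λ i → x i + ½ ^ k * v i) - F x
  first-order x v x∈ y∈ η 0<η with grad (tabulate x) (inCube x∈) η 0<η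
  -- The added 1 makes `½ ^ k * ∥ v ∥` strictly smaller than δ, as the definition of the gradient
  -- demands.
  ... | δ , 0<δ , approx with 2^-unbounded ((∥ v ∥ + 1#) * δ ⁻¹)
  ... | k , V+1/δ≤2ᵏ = k ,
    by (gap (≤-trans (x≤∣x∣ (g - s * D)) error))
      (solve 5 (λ s D η V g → s :* (D :+ η :* V) := g :+ (η :* (s :* V) :- (g :- s :* D))) refl s D η V g) ,
    by (gap (≤-trans (-x≤∣x∣ (g - s * D)) error))
      (solve 5 (λ s D η V g → g := s :* (D :- η :* V) :+ (η :* (s :* V) :- (:- (g :- s :* D)))) refl s D η V g)
    where
    open ≡-Reasoning
    s = ½ ^ k
    V = ∥ v ∥
    z : Point n
    z i = x i + s * v i
    z-x : ∀ i → z i - x i ≡ s * v i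
    z-x i = solve 2 (λ x u → x :+ u :- x := u) refl (x i) (s * v i)
    norm : ‖ tabulate z -ᵛ tabulate x ‖₁ ≡ s * V
    norm = begin
      ‖ tabulate z -ᵛ tabulate x ‖₁   ≡⟨ ‖‖₁-tabulate x z ⟩
      sum (λ i → ∣ z i - x i ∣)       ≡⟨ sum-cong-≗ (λ i → trans (cong ∣_∣ (z-x i)) (∣∣-scale (proj₁ (0<½^ k)) (v i))) ⟩
      sum (λ i → s * ∣ v i ∣)         ≡⟨ *-distribˡ-sum s (λ i → ∣ v i ∣) ⟨
      s * V                           ∎
    dot : ⟨ ∇f (tabulate x) , tabulate z -ᵛ tabulate x ⟩ ≡ s * ∇F x ∙ v
    dot = begin
      ⟨ ∇f (tabulate x) , tabulate z -ᵛ tabulate x ⟩  ≡⟨ ⟨⟩-tabulate (∇f (tabulate x)) x z ⟩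
      ∇F x ∙ (λ i → z i - x i)                        ≡⟨ sum-cong-≗ (λ i → cong (∇F x i *_) (z-x i)) ⟩
      ∇F x ∙ (λ i → s * v i)                          ≡⟨ ∙-scaleʳ s (∇F x) v ⟩
      s * ∇F x ∙ v                                    ∎
    D = ∇F x ∙ v
    g = F z - F x
    sV+s≤δ : s * V + s ≤ δ
    sV+s≤δ = by ((proj₁ 0<δ ⊠ proj₁ (0<½^ k)) ⊠ gap V+1/δ≤2ᵏ) (begin
      δ
        ≡⟨ solve 3 (λ δ s V → δ := s :* V :+ s :+ δ :* :1 :- :1 :* s :* (V :+ :1)) refl δ s V ⟩
      s * V + s + δ * 1# - 1# * s * (V + 1#)
        ≡⟨ cong₂ (λ a b → s * V + s + δ * a - b * s * (V + 1#)) (2^*½^ k) (*⁻¹ 0<δ) ⟨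
      s * V + s + δ * (2# ^ k * s) - δ * δ ⁻¹ * s * (V + 1#)
        ≡⟨ solve 5 (λ δ s V p i → s :* V :+ s :+ δ :* (p :* s) :- δ :* i :* s :* (V :+ :1) :=
             s :* V :+ s :+ δ :* s :* (p :- (V :+ :1) :* i)) refl δ s V (2# ^ k) (δ ⁻¹) ⟩
      s * V + s + δ * s * (2# ^ k - (V + 1#) * δ ⁻¹) ∎)
    sV<δ : s * V < δ
    sV<δ = <-≤-trans (≰⇒> λ sV+s≤sV → <⇒≱ (0<½^ k)
      (by (gap sV+s≤sV) (solve 2 (λ s w → :0 := s :+ (w :- (w :+ s))) refl s (s * V)))) sV+s≤δ
    error : ∣ g - s * D ∣ ≤ η * (s * V)
    error = subst₂ (λ d m → ∣ g - d ∣ ≤ η * m) dot norm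
      (approx (tabulate z) (inCube (segment∈ (proj₁ (0<½^ k)) (½^≤1 k) x∈ y∈)) (subst (_< δ) (sym norm) sV<δ))

  -- By diminishing returns the lower half of a segment gains at least as much as
  -- the upper half; halving repeatedly towards one of its ends compares the gain
  -- with the derivative there, without a mean value theorem.
  module _ (x v : Point n) (0≤x : ∀ i → 0# ≤ x i) (0≤v : ∀ i → 0# ≤ v i) (y≤1 : ∀ i → x i + v i ≤ 1#) where

    private
      y : Point n
      y i = x i + v i

      x∈ : Unit x
      x∈ i = 0≤x i , ≤-trans (by (0≤v i) refl) (y≤1 i)

      y∈ : Unit y
      y∈ i = 0≤x i ⊞ 0≤v i , y≤1 i

      up down : ℝ → Point n
      up s i   = x i + s * v i
      down s i = y i + s * - v i

      up-≤1 : ∀ {s} → 0# ≤ s → s ≤ 1# → ∀ i → up s i ≤ 1#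
      up-≤1 0≤s s≤1 i = proj₂ (segment∈ 0≤s s≤1 x∈ y∈ i)

      x∈′ : Unit (λ i → y i - v i)
      x∈′ i = subst (λ t → 0# ≤ t × t ≤ 1#) (solve 2 (λ x v → x := x :+ v :- v) refl (x i) (v i)) (x∈ i)

    halving-up : ∀ k → F y - F x ≤ 2# ^ k * (F (up (½ ^ k)) - F x)
    halving-up zero = ≤-reflexive (trans (sym (*-identityˡ _))
      (cong (λ t → 1# * (t - F x)) (F-cong (λ i → cong (λ u → x i + u) (sym (*-identityˡ (v i)))))))
    halving-up (suc k) = ≤-trans (halving-up k)
      (by (0≤2^ k ⊠ gap diminish)
        (solve 4 (λ p a b c → :2 :* p :* (b :- a) := p :* (c :- a) :+ p :* (b :- a :- (c :- b))) refl
          (2# ^ k) (F x) (F (up (½ * s))) (F (up s))))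
      where
      s = ½ ^ k
      0≤½s = proj₁ (0<½^ (suc k))
      join : (λ i → up (½ * s) i + ½ * s * v i) ≗ up s
      join i = trans (solve 2 (λ x u → x :+ u :+ u := x :+ (u :+ u)) refl (x i) (½ * s * v i))
        (cong (λ u → x i + u) (halve-sum s (v i)))
      diminish : F (up s) - F (up (½ * s)) ≤ F (up (½ * s)) - F x
      diminish = subst (λ t → t - F (up (½ * s)) ≤ F (up (½ * s)) - F x) (F-cong join)
        (F-increment x (up (½ * s)) (λ i → ½ * s * v i) 0≤x
          (λ i → by (0≤½s ⊠ 0≤v i) refl) (λ i → 0≤½s ⊠ 0≤v i)
          (λ i → subst (_≤ 1#) (sym (join i)) (up-≤1 (proj₁ (0<½^ k)) (½^≤1 k) i)))

    halving-down : ∀ k → 2# ^ k * (F y - F (down (½ ^ k))) ≤ F y - F x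
    halving-down zero = ≤-reflexive (trans (*-identityˡ _)
      (cong (λ t → F y - t) (F-cong (λ i → solve 2 (λ x v → x :+ v :+ :1 :* (:- v) := x) refl (x i) (v i)))))
    halving-down (suc k) = ≤-trans
      (by (0≤2^ k ⊠ gap diminish)
        (solve 4 (λ p a b c → p :* (c :- a) := :2 :* p :* (c :- b) :+ p :* (b :- a :- (c :- b))) refl
          (2# ^ k) (F (down s)) (F (down (½ * s))) (F y)))
      (halving-down k)
      where
      s = ½ ^ k
      0≤½s = proj₁ (0<½^ (suc k))
      join₁ : (λ i → down s i + ½ * s * v i) ≗ down (½ * s)
      join₁ i = begin
        y i + s * - v i + u           ≡⟨ solve 4 (λ y s v u → y :+ s :* (:- v) :+ u := y :- s :* v :+ u) refl (y i) s (v i) u ⟩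
        y i - s * v i + u             ≡⟨ cong (λ t → y i - t + u) (halve-sum s (v i)) ⟨
        y i - (u + u) + u             ≡⟨ solve 4 (λ y h s v → y :- (h :* s :* v :+ h :* s :* v) :+ h :* s :* v := y :+ h :* s :* (:- v)) refl (y i) ½ s (v i) ⟩
        down (½ * s) i                ∎
        where
        open ≡-Reasoning
        u = ½ * s * v i
      join₂ : (λ i → down (½ * s) i + ½ * s * v i) ≗ y
      join₂ i = solve 3 (λ y s v → y :+ s :* (:- v) :+ s :* v := y) refl (y i) (½ * s) (v i)
      diminish : F y - F (down (½ * s)) ≤ F (down (½ * s)) - F (down s)
      diminish = subst₂ (λ t u → t - F (down (½ * s)) ≤ u - F (down s)) (F-cong join₂) (F-cong join₁)
        (F-increment (down s) (down (½ * s)) (λ i → ½ * s * v i)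
          (λ i → proj₁ (segment∈ (proj₁ (0<½^ k)) (½^≤1 k) y∈ x∈′ i))
          (λ i → by (0≤½s ⊠ 0≤v i) (sym (join₁ i))) (λ i → 0≤½s ⊠ 0≤v i)
          (λ i → subst (_≤ 1#) (sym (join₂ i)) (y≤1 i)))

    gain-≤-gradient : F y - F x ≤ ∇F x ∙ v
    gain-≤-gradient = ≤-limit (0≤∥∥ v) bound
      where
      bound : ∀ η → 0# < η → F y - F x ≤ ∇F x ∙ v + η * ∥ v ∥
      bound η 0<η = let k , g≤ , _ = first-order x v x∈ y∈ η 0<η in ≤-trans (halving-up k) (rescale k g≤)

    gradient-≤-gain : ∇F y ∙ v ≤ F y - F x
    gradient-≤-gain = ≤-limit (0≤∥∥ w) bound
      where
      w : Point n
      w i = - v i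
      dot : ∇F y ∙ w ≡ - (∇F y ∙ v)
      dot = begin
        ∇F y ∙ w                    ≡⟨ sum-cong-≗ (λ i → solve 2 (λ g v → g :* (:- v) := g :* ((:- :1) :* v)) refl (∇F y i) (v i)) ⟩
        ∇F y ∙ (λ i → - 1# * v i)   ≡⟨ ∙-scaleʳ (- 1#) (∇F y) v ⟩
        - 1# * ∇F y ∙ v             ≡⟨ solve 1 (λ d → (:- :1) :* d := :- d) refl (∇F y ∙ v) ⟩
        - (∇F y ∙ v)                ∎
        where open ≡-Reasoning
      bound : ∀ η → 0# < η → ∇F y ∙ v ≤ F y - F x + η * ∥ w ∥
      bound η 0<η = let k , g≤ , _ = first-order y w y∈ x∈′ η 0<η in by (gap (rescale k g≤) ⊞ gap (halving-down k))
        (trans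
          (solve 5 (λ D N a p e → a :+ N := D :+ (:- D :+ N :- p :* e :+ (a :- p :* (:- e)))) refl
            (∇F y ∙ v) (η * ∥ w ∥) (F y - F x) (2# ^ k) (F (down (½ ^ k)) - F y))
          (cong₂ (λ E e → ∇F y ∙ v + (E + η * ∥ w ∥ - 2# ^ k * (F (down (½ ^ k)) - F y) + (F y - F x - 2# ^ k * e)))
            (sym dot) (solve 2 (λ a b → :- (b :- a) := a :- b) refl (F y) (F (down (½ ^ k))))))

  module _ {x y : Point n} (0≤x : ∀ i → 0# ≤ x i) (x≤y : ∀ i → x i ≤ y i) (y≤1 : ∀ i → y i ≤ 1#) where

    private
      x+[y-x] : (λ i → x i + (y i - x i)) ≗ y
      x+[y-x] i = solve 2 (λ x y → x :+ (y :- x) := y) refl (x i) (y i)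

      x+[y-x]≤1 : ∀ i → x i + (y i - x i) ≤ 1#
      x+[y-x]≤1 i = subst (_≤ 1#) (sym (x+[y-x] i)) (y≤1 i)

    rise-≤ : F y - F x ≤ ∇F x ∙ (λ i → y i - x i)
    rise-≤ = subst (λ t → t - F x ≤ ∇F x ∙ (λ i → y i - x i)) (F-cong x+[y-x])
      (gain-≤-gradient x (λ i → y i - x i) 0≤x (λ i → gap (x≤y i)) x+[y-x]≤1)

    rise-≥ : ∇F y ∙ (λ i → y i - x i) ≤ F y - F x
    rise-≥ = subst₂ (λ t u → t ≤ u - F x)
      (sum-cong-≗ (λ i → cong (_* (y i - x i)) (∇F-cong x+[y-x] i))) (F-cong x+[y-x])
      (gradient-≤-gain x (λ i → y i - x i) 0≤x (λ i → gap (x≤y i)) x+[y-x]≤1)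

  -- The room ρ lets both points rise by the same small increment, whose gains diminishing returns
  -- compare. The gain at `x` is bounded by the derivative without error, so a single k, chosen for
  -- `y`, is enough.
  ∇F-antitone : ∀ x y {ρ} → 0# < ρ → (∀ i → 0# ≤ x i) → (∀ i → x i ≤ y i) → (∀ i → y i + ρ ≤ 1#) →
    ∀ i → ∇F y i ≤ ∇F x i
  ∇F-antitone x y {ρ} 0<ρ 0≤x x≤y y+ρ≤1 = ∙-reflects-≤ 0<ρ directional
    where
    directional : ∀ v → (∀ i → 0# ≤ v i × v i ≤ ρ) → ∇F y ∙ v ≤ ∇F x ∙ v
    directional v v-bounds = ≤-limit (0≤∥∥ v) bound
      where
      y+v≤1 : ∀ i → y i + v i ≤ 1#
      y+v≤1 i = ≤-trans
        (by (gap (proj₂ (v-bounds i))) (solve 3 (λ y ρ v → y :+ ρ := y :+ v :+ (ρ :- v)) refl (y i) ρ (v i)))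
        (y+ρ≤1 i)
      y∈ : Unit y
      y∈ i = ≤-trans (0≤x i) (x≤y i) , ≤-trans (by (proj₁ 0<ρ) refl) (y+ρ≤1 i)
      y+v∈ : Unit (λ i → y i + v i)
      y+v∈ i = proj₁ (y∈ i) ⊞ proj₁ (v-bounds i) , y+v≤1 i
      bound : ∀ η → 0# < η → ∇F y ∙ v ≤ ∇F x ∙ v + η * ∥ v ∥
      bound η 0<η = let k , _ , ≤g = first-order y v y∈ y+v∈ η 0<η in
        by (gap (*-cancel-≤ (0<½^ k) (≤-trans ≤g (≤-trans (diminish k) (upper k)))))
          (solve 3 (λ a b c → b :+ c := a :+ (b :- (a :- c))) refl (∇F y ∙ v) (∇F x ∙ v) (η * ∥ v ∥))
        where
        module _ (k : ℕ) where
          s = ½ ^ k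
          0≤sv : ∀ i → 0# ≤ s * v i
          0≤sv i = proj₁ (0<½^ k) ⊠ proj₁ (v-bounds i)
          y+sv≤1 : ∀ i → y i + s * v i ≤ 1#
          y+sv≤1 i = proj₂ (segment∈ (proj₁ (0<½^ k)) (½^≤1 k) y∈ y+v∈ i)
          diminish : F (λ i → y i + s * v i) - F y ≤ F (λ i → x i + s * v i) - F x
          diminish = F-increment x y (λ i → s * v i) 0≤x x≤y 0≤sv y+sv≤1
          upper : F (λ i → x i + s * v i) - F x ≤ s * ∇F x ∙ v
          upper = subst (F (λ i → x i + s * v i) - F x ≤_) (∙-scaleʳ s (∇F x) v)
            (gain-≤-gradient x (λ i → s * v i) 0≤x 0≤sv
              (λ i → ≤-trans (+-mono-≤ (s * v i) (x≤y i)) (y+sv≤1 i)))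

  -- The derivative at the intermediate point `m` is a supergradient towards both ends of the
  -- segment.
  F-concave : ∀ x v {l} → (∀ i → 0# ≤ x i) → (∀ i → 0# ≤ v i) → (∀ i → x i + v i ≤ 1#) →
    0# ≤ l → l ≤ 1# → (1# - l) * F x + l * F (λ i → x i + v i) ≤ F (λ i → x i + l * v i)
  F-concave x v {l} 0≤x 0≤v x+v≤1 0≤l l≤1 =
    by (gap l≤1 ⊠ gap lower ⊞ 0≤l ⊠ gap upper)
      (solve 5 (λ l a b m d → m := (:1 :- l) :* a :+ l :* b :+
          ((:1 :- l) :* (m :- a :- l :* d) :+ l :* ((:1 :- l) :* d :- (b :- m)))) refl
        l (F x) (F (λ i → x i + v i)) (F m) (∇F m ∙ v))
    where
    m : Point n
    m i = x i + l * v i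
    0≤lv : ∀ i → 0# ≤ l * v i
    0≤lv i = 0≤l ⊠ 0≤v i
    join : (λ i → m i + (1# - l) * v i) ≗ (λ i → x i + v i)
    join i = solve 3 (λ x l v → x :+ l :* v :+ (:1 :- l) :* v := x :+ v) refl (x i) l (v i)
    lower : l * ∇F m ∙ v ≤ F m - F x
    lower = subst (_≤ F m - F x) (∙-scaleʳ l (∇F m) v)
      (gradient-≤-gain x (λ i → l * v i) 0≤x 0≤lv
        (λ i → ≤-trans (by (gap l≤1 ⊠ 0≤v i) (sym (join i))) (x+v≤1 i)))
    upper : F (λ i → x i + v i) - F m ≤ (1# - l) * ∇F m ∙ v
    upper = subst₂ (λ a b → a - F m ≤ b) (F-cong join) (∙-scaleʳ (1# - l) (∇F m) v)
      (gain-≤-gradient m (λ i → (1# - l) * v i) (λ i → 0≤x i ⊞ 0≤lv i) (λ i → gap l≤1 ⊠ 0≤v i)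
        (λ i → subst (_≤ 1#) (sym (join i)) (x+v≤1 i)))

-- Balancing, the run, and clamping one coordinate.

module DoubleGreedy (em : ExcludedMiddle 0ℓ) (𝓡 : CompleteOrderedField) where

  open DRSubmodularMaximization 𝓡
  open OrderedField em 𝓡
  open Points em 𝓡

  -- First-order growth of f(x) + f(y) per unit of time when x rises at speed r and y falls at speed
  -- 1 - r.
  rate : ℝ → ℝ → ℝ → ℝ
  rate a b r = a * r + b * (1# - r)

  -- `bᵣ` and `aᵣ` pay for pushing the optimum up by δ r or down by δ (1 - r), at a loss of half the
  -- gain; `sᵣ` bounds the contribution to S by the gain.
  record Balanced (a b r : ℝ) : Set where
    field
      bᵣ : 2# * (b * r) ≤ rate a b r
      aᵣ : 2# * (a * (1# - r)) ≤ rate a b r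
      sᵣ : a + b ≤ 2# * rate a b r

  -- If both are positive, r = a / (a + b), and all three inequalities have a nonnegative multiple
  -- of (a + b) (1 - 2r)² as slack; otherwise r is an endpoint. The choice must be made for
  -- arbitrary oracle answers, whereas a + b ≥ 0 is a property of the gradient of a DR-submodular
  -- function; hence it is a premise of `Balanced` alone.
  ratio : ∀ a b → ∃[ r ] (0# ≤ r × r ≤ 1#) × (0# ≤ a + b → Balanced a b r)
  ratio a b with em {a ≤ 0#} | em {b ≤ 0#}
  ... | yes a≤0 | _ = 0# , (≤-refl , 0≤1) , λ 0≤a+b → record
    { bᵣ = by (0≤a+b ⊞ 0≤neg a≤0)
        (solve 2 (λ a b → a :* :0 :+ b :* (:1 :- :0) := :2 :* (b :* :0) :+ (a :+ b :+ :- a)) refl a b)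
    ; aᵣ = by (0≤a+b ⊞ 0≤neg a≤0 ⊞ 0≤neg a≤0 ⊞ 0≤neg a≤0)
        (solve 2 (λ a b → a :* :0 :+ b :* (:1 :- :0) := :2 :* (a :* (:1 :- :0)) :+ (a :+ b :+ :- a :+ :- a :+ :- a)) refl a b)
    ; sᵣ = by (0≤a+b ⊞ 0≤neg a≤0 ⊞ 0≤neg a≤0)
        (solve 2 (λ a b → :2 :* (a :* :0 :+ b :* (:1 :- :0)) := a :+ b :+ (a :+ b :+ :- a :+ :- a)) refl a b)
    }
  ... | no _ | yes b≤0 = 1# , (0≤1 , ≤-refl) , λ 0≤a+b → record
    { bᵣ = by (0≤a+b ⊞ 0≤neg b≤0 ⊞ 0≤neg b≤0 ⊞ 0≤neg b≤0)
        (solve 2 (λ a b → a :* :1 :+ b :* (:1 :- :1) := :2 :* (b :* :1) :+ (a :+ b :+ :- b :+ :- b :+ :- b)) refl a b)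
    ; aᵣ = by (0≤a+b ⊞ 0≤neg b≤0)
        (solve 2 (λ a b → a :* :1 :+ b :* (:1 :- :1) := :2 :* (a :* (:1 :- :1)) :+ (a :+ b :+ :- b)) refl a b)
    ; sᵣ = by (0≤a+b ⊞ 0≤neg b≤0 ⊞ 0≤neg b≤0)
        (solve 2 (λ a b → :2 :* (a :* :1 :+ b :* (:1 :- :1)) := a :+ b :+ (a :+ b :+ :- b :+ :- b)) refl a b)
    }
  ... | no a≰0 | no b≰0 = r , (0≤a ⊠ 0≤i , by (0≤b ⊠ 0≤i) 1≡) , λ _ → record
    { bᵣ = subst₂ (λ a b → 2# * (b * r) ≤ rate a b r) (sym a≡) (sym b≡)
        (by 0≤square (solve 2 (λ r s → s :* r :* r :+ s :* (:1 :- r) :* (:1 :- r) :=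
          :2 :* (s :* (:1 :- r) :* r) :+ s :* ((:1 :- :2 :* r) :* (:1 :- :2 :* r))) refl r (a + b)))
    ; aᵣ = subst₂ (λ a b → 2# * (a * (1# - r)) ≤ rate a b r) (sym a≡) (sym b≡)
        (by 0≤square (solve 2 (λ r s → s :* r :* r :+ s :* (:1 :- r) :* (:1 :- r) :=
          :2 :* (s :* r :* (:1 :- r)) :+ s :* ((:1 :- :2 :* r) :* (:1 :- :2 :* r))) refl r (a + b)))
    ; sᵣ = subst₂ (λ a′ b′ → a + b ≤ 2# * rate a′ b′ r) (sym a≡) (sym b≡)
        (by 0≤square (solve 2 (λ r s → :2 :* (s :* r :* r :+ s :* (:1 :- r) :* (:1 :- r)) :=
          s :+ s :* ((:1 :- :2 :* r) :* (:1 :- :2 :* r))) refl r (a + b)))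
    }
    where
    open ≡-Reasoning
    0≤a = ≰⇒≥ a≰0
    0≤b = ≰⇒≥ b≰0
    0<s : 0# < a + b
    0<s = <-≤-trans (≰⇒> a≰0) (by 0≤b refl)
    i = (a + b) ⁻¹
    0≤i : 0# ≤ i
    0≤i = 0≤⁻¹ 0<s
    r = a * i
    1≡ : 1# ≡ r + b * i
    1≡ = trans (sym (*⁻¹ 0<s)) (solve 3 (λ a b i → (a :+ b) :* i := a :* i :+ b :* i) refl a b i)
    a≡ : a ≡ (a + b) * r
    a≡ = begin
      a                  ≡⟨ *-identityʳ a ⟨
      a * 1#             ≡⟨ cong (a *_) (*⁻¹ 0<s) ⟨
      a * ((a + b) * i)  ≡⟨ solve 3 (λ a s i → a :* (s :* i) := s :* (a :* i)) refl a (a + b) i ⟩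
      (a + b) * r        ∎
    b≡ : b ≡ (a + b) * (1# - r)
    b≡ = begin
      b                       ≡⟨ solve 2 (λ a b → b := a :+ b :- a) refl a b ⟩
      a + b - a               ≡⟨ cong (λ c → a + b - c) a≡ ⟩
      a + b - (a + b) * r     ≡⟨ solve 2 (λ s r → s :- s :* r := s :* (:1 :- r)) refl (a + b) r ⟩
      (a + b) * (1# - r)      ∎
    0≤square : 0# ≤ (a + b) * ((1# - 2# * r) * (1# - 2# * r))
    0≤square = proj₁ 0<s ⊠ 0≤x² (1# - 2# * r)

  0≤rate : ∀ {a b r} → 0# ≤ a + b → Balanced a b r → 0# ≤ rate a b r
  0≤rate {a} {b} {r} 0≤s bal = *-cancel-≤ 0<2
    (subst (_≤ 2# * rate a b r) (sym (zeroʳ 2#)) (≤-trans 0≤s (Balanced.sᵣ bal)))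

  duration : List ℝ → ℝ
  duration = foldr _+_ 0#

  NonNegatives : List ℝ → Set
  NonNegatives = ListAll.All (0# ≤_)

  0≤duration : ∀ {δs} → NonNegatives δs → 0# ≤ duration δs
  0≤duration []         = ≤-refl
  0≤duration (0≤δ ∷ ps) = 0≤δ ⊞ 0≤duration ps

  -- The lower point x is the state; the upper point is x + duration δs in every
  -- coordinate, so the two points meet exactly when the steps are used up.
  module _ {n : ℕ} where

    fraction : Point n → Point n → Point n
    fraction g h i = proj₁ (ratio (g i) (- h i))

    advance : ℝ → Point n → Point n → Point n → Point n
    advance δ g h x i = x i + δ * fraction g h i

    0≤fraction : ∀ g h i → 0# ≤ fraction g h i
    0≤fraction g h i = proj₁ (proj₁ (proj₂ (ratio (g i) (- h i))))

    fraction≤1 : ∀ g h i → fraction g h i ≤ 1#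
    fraction≤1 g h i = proj₂ (proj₁ (proj₂ (ratio (g i) (- h i))))

    advance-lower : ∀ {δ} → 0# ≤ δ → ∀ g h {x} → (∀ i → 0# ≤ x i) → ∀ i → 0# ≤ advance δ g h x i
    advance-lower 0≤δ g h 0≤x i = 0≤x i ⊞ 0≤δ ⊠ 0≤fraction g h i

    advance-upper : ∀ {δ} → 0# ≤ δ → ∀ g h x w i → advance δ g h x i + w ≤ x i + (δ + w)
    advance-upper {δ} 0≤δ g h x w i = by (0≤δ ⊠ gap (fraction≤1 g h i))
      (solve 4 (λ x δ r w → x :+ (δ :+ w) := x :+ δ :* r :+ w :+ δ :* (:1 :- r)) refl (x i) δ (fraction g h i) w)

    run : ∀ δs → NonNegatives δs → (x : Point n) → (∀ i → 0# ≤ x i) → (∀ i → x i + duration δs ≤ 1#) →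
      Algorithm n
    run [] _ x 0≤x x≤1 =
      return (tabulate x , inCube (λ i → 0≤x i , subst (_≤ 1#) (+-identityʳ (x i)) (x≤1 i)))
    run (δ ∷ δs) (0≤δ ∷ 0≤δs) x 0≤x y≤1 = round
      ((tabulate x , inCube (λ i → 0≤x i , ≤-trans (by 0≤w refl) (y≤1 i)))
        ∷ (tabulate (λ i → x i + duration (δ ∷ δs)) , inCube (λ i → 0≤x i ⊞ 0≤w , y≤1 i))
        ∷ [])
      λ { ((_ , g) ∷ (_ , h) ∷ []) →
          run δs 0≤δs (advance δ (lookup g) (lookup h) x)
            (advance-lower 0≤δ (lookup g) (lookup h) 0≤x)
            (λ i → ≤-trans (advance-upper 0≤δ (lookup g) (lookup h) x (duration δs) i) (y≤1 i)) }
      where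
      0≤w : 0# ≤ duration (δ ∷ δs)
      0≤w = 0≤δ ⊞ 0≤duration 0≤δs

    rounds-run : ∀ f ∇f δs 0≤δs x 0≤x y≤1 → rounds f ∇f (run δs 0≤δs x 0≤x y≤1) ≡ length δs
    rounds-run f ∇f []       _            x 0≤x y≤1 = refl
    rounds-run f ∇f (δ ∷ δs) (_ ∷ 0≤δs) x 0≤x y≤1 = cong suc (rounds-run f ∇f δs 0≤δs _ _ _)

    evaluations-run : ∀ f ∇f δs 0≤δs x 0≤x y≤1 → evaluations f ∇f (run δs 0≤δs x 0≤x y≤1) ≡ length δs ℕ.* 2
    evaluations-run f ∇f []       _            x 0≤x y≤1 = refl
    evaluations-run f ∇f (δ ∷ δs) (_ ∷ 0≤δs) x 0≤x y≤1 = cong (λ k → suc (suc k)) (evaluations-run f ∇f δs 0≤δs _ _ _)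

  -- t is the time on the clock before the first step.
  Gradual : ℝ → ℝ → List ℝ → Set
  Gradual η t []       = ⊤
  Gradual η t (δ ∷ δs) = δ ≤ η * (t + δ) × Gradual η (t + δ) δs

  -- A clamped coordinate may move by less than δ r. For b ≥ 0 the full distance is the worst case;
  -- for b ≤ 0 nothing is lost at all.
  drop-≤ : ∀ {b e δ r c} → 0# ≤ e → e ≤ δ * r → 0# ≤ δ → 2# * (b * r) ≤ c → 0# ≤ c → 2# * (b * e) ≤ δ * c
  drop-≤ {b} {e} {δ} {r} {c} 0≤e e≤δr 0≤δ 2br≤c 0≤c with total 0# b
  ... | inj₁ 0≤b = by (0≤2 ⊠ (0≤b ⊠ gap e≤δr) ⊞ 0≤δ ⊠ gap 2br≤c)
    (solve 5 (λ b e δ r c → δ :* c := :2 :* (b :* e) :+ (:2 :* (b :* (δ :* r :- e)) :+ δ :* (c :- :2 :* (b :* r)))) refl b e δ r c)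
  ... | inj₂ b≤0 = by (0≤2 ⊠ (0≤neg b≤0 ⊠ 0≤e) ⊞ 0≤δ ⊠ 0≤c)
    (solve 4 (λ b e δ c → δ :* c := :2 :* (b :* e) :+ (:2 :* ((:- b) :* e) :+ δ :* c)) refl b e δ c)

  -- Passing through `q` splits the displacement from `p` to `p′` into a rise and a fall, each of
  -- which the gradient inequalities for ordered points can estimate.
  record Clamped (a b r δ w x p : ℝ) : Set where
    constructor clamped
    field
      q p′  : ℝ
      p≤q   : p ≤ q
      p′≤q  : p′ ≤ q
      q≤y   : q ≤ x + (δ + w)
      x′≤p′ : x + δ * r ≤ p′
      p′≤y′ : p′ ≤ x + δ * r + w
      drop  : 2# * (b * (q - p) + a * (q - p′)) ≤ δ * rate a b r

  -- p′ is the point of [x + δr , x + δr + w] nearest to p and q the larger of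
  -- p and p′; at most one of the two differences is nonzero.
  clamp : ∀ {a b r δ w x p} → 0# ≤ a + b → Balanced a b r → r ≤ 1# → 0# ≤ δ → 0# ≤ w →
    x ≤ p → p ≤ x + (δ + w) → Clamped a b r δ w x p
  clamp {a} {b} {r} {δ} {w} {x} {p} 0≤s bal r≤1 0≤δ 0≤w x≤p p≤y
    with total p (x + δ * r) | total p (x + δ * r + w)
  ... | inj₁ p≤x′ | _ = clamped x′ x′ p≤x′ ≤-refl
      (by (0≤δ ⊠ gap r≤1 ⊞ 0≤w)
        (solve 4 (λ x δ r w → x :+ (δ :+ w) := x :+ δ :* r :+ (δ :* (:1 :- r) :+ w)) refl x δ r w))
      ≤-refl (by 0≤w refl)
      (subst (_≤ δ * rate a b r)
        (solve 4 (λ a b x p → :2 :* (b :* (x :- p)) := :2 :* (b :* (x :- p) :+ a :* (x :- x))) refl a b x′ p)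
        (drop-≤ {b} (gap p≤x′)
          (by (gap x≤p) (solve 3 (λ x p e → e := x :+ e :- p :+ (p :- x)) refl x p (δ * r)))
          0≤δ (Balanced.bᵣ bal) (0≤rate 0≤s bal)))
    where x′ = x + δ * r
  ... | inj₂ x′≤p | inj₁ p≤y′ = clamped p p ≤-refl ≤-refl p≤y x′≤p p≤y′
      (subst (_≤ δ * rate a b r)
        (solve 3 (λ a b p → :0 := :2 :* (b :* (p :- p) :+ a :* (p :- p))) refl a b p)
        (0≤δ ⊠ 0≤rate 0≤s bal))
  ... | inj₂ _    | inj₂ y′≤p = clamped p y′ ≤-refl y′≤p p≤y (by 0≤w refl) ≤-refl
      (subst (_≤ δ * rate a b r)
        (solve 4 (λ a b y p → :2 :* (a :* (p :- y)) := :2 :* (b :* (p :- p) :+ a :* (p :- y))) refl a b y′ p)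
        (drop-≤ {a} (gap y′≤p)
          (by (gap p≤y) (solve 5 (λ x p δ r w → δ :* (:1 :- r) := p :- (x :+ δ :* r :+ w) :+ (x :+ (δ :+ w) :- p)) refl x p δ r w))
          0≤δ (Balanced.aᵣ bal) (0≤rate 0≤s bal)))
    where y′ = x + δ * r + w

  -- With Q = δS and Q′ = δS′ the hypotheses are those of one step, and the sum of
  -- the terms Q - Q′ - ηQ over all steps telescopes along a gradual sequence.
  step-potential : ∀ {η d P Q Q′ Δ} → 0# ≤ η → 0# ≤ 1# - 2# * η →
    2# * d ≤ P → Q ≤ 2# * P → P + Q′ ≤ Δ + Q → (2# - 2# * 2# * η) * d ≤ Δ + (Q - Q′ - η * Q)
  step-potential {η} {d} {P} {Q} {Q′} {Δ} 0≤η 0≤k 2d≤P Q≤2P P+Q′≤Δ+Q =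
    by (0≤k ⊠ gap 2d≤P ⊞ 0≤η ⊠ gap Q≤2P ⊞ gap P+Q′≤Δ+Q)
      (solve 6 (λ η d P Q Q′ Δ → Δ :+ (Q :- Q′ :- η :* Q) := (:2 :- :2 :* :2 :* η) :* d :+
        ((:1 :- :2 :* η) :* (P :- :2 :* d) :+ η :* (:2 :* P :- Q) :+ (Δ :+ Q :- (P :+ Q′)))) refl η d P Q Q′ Δ)

-- Analysis of one step and of a whole run.

module DoubleGreedyAnalysis (em : ExcludedMiddle 0ℓ) (𝓡 : CompleteOrderedField)
  {n : ℕ} (f : Vec (CompleteOrderedField.Carrier 𝓡) n → CompleteOrderedField.Carrier 𝓡)
  (∇f : Vec (CompleteOrderedField.Carrier 𝓡) n → Vec (CompleteOrderedField.Carrier 𝓡) n)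
  (dr : DRSubmodularMaximization.DRSubmodular 𝓡 f)
  (grad : DRSubmodularMaximization.IsGradient 𝓡 f ∇f) where

  open DRSubmodularMaximization 𝓡
  open OrderedField em 𝓡
  open Points em 𝓡
  open DRCalculus em 𝓡 f ∇f dr grad
  open DoubleGreedy em 𝓡

  slope : Point n → ℝ → ℝ
  slope x w = sum (λ i → ∇F x i - ∇F (λ j → x j + w) i)

  module Step {ρ δ w : ℝ} (0<ρ : 0# < ρ) (0≤δ : 0# ≤ δ) (0≤w : 0# ≤ w) (x : Point n)
    (0≤x : ∀ i → 0# ≤ x i) (y+ρ≤1 : ∀ i → x i + (δ + w) + ρ ≤ 1#) where

    y x′ y′ : Point n
    y i = x i + (δ + w)
    x′ = advance δ (∇F x) (∇F y) x
    y′ i = x′ i + w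

    private
      a h a′ h′ r c : Point n
      a  = ∇F x
      h  = ∇F y
      a′ = ∇F x′
      h′ = ∇F y′
      r  = fraction a h
      c i = rate (a i) (- h i) (r i)

      y≤1 : ∀ i → y i ≤ 1#
      y≤1 i = ≤-trans (by (proj₁ 0<ρ) refl) (y+ρ≤1 i)

      room : ∀ {z : Point n} → (∀ i → z i ≤ y i) → ∀ i → z i + ρ ≤ 1#
      room z≤y i = ≤-trans (+-mono-≤ ρ (z≤y i)) (y+ρ≤1 i)

      x≤x′ : ∀ i → x i ≤ x′ i
      x≤x′ i = by (0≤δ ⊠ 0≤fraction a h i) refl

      x′≤y′ : ∀ i → x′ i ≤ y′ i
      x′≤y′ i = by 0≤w refl

      y′≤y : ∀ i → y′ i ≤ y i
      y′≤y = advance-upper 0≤δ a h x w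

      0≤x′ : ∀ i → 0# ≤ x′ i
      0≤x′ = advance-lower 0≤δ a h 0≤x

      antitone : ∀ {u v : Point n} → (∀ i → 0# ≤ u i) → (∀ i → u i ≤ v i) → (∀ i → v i ≤ y i) →
        ∀ i → ∇F v i ≤ ∇F u i
      antitone 0≤u u≤v v≤y = ∇F-antitone _ _ 0<ρ 0≤u u≤v (room v≤y)

      h≤h′ : ∀ i → h i ≤ h′ i
      h≤h′ = antitone (λ i → 0≤x′ i ⊞ 0≤w) y′≤y (λ _ → ≤-refl)

      h′≤a′ : ∀ i → h′ i ≤ a′ i
      h′≤a′ = antitone 0≤x′ x′≤y′ y′≤y

      a′≤a : ∀ i → a′ i ≤ a i
      a′≤a = antitone 0≤x x≤x′ (λ i → ≤-trans (x′≤y′ i) (y′≤y i))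

      0≤s : ∀ i → 0# ≤ a i - h i
      0≤s i = gap (≤-trans (h≤h′ i) (≤-trans (h′≤a′ i) (a′≤a i)))

      balanced : ∀ i → Balanced (a i) (- h i) (r i)
      balanced i = proj₂ (proj₂ (ratio (a i) (- h i))) (0≤s i)

    Γ : ℝ
    Γ = sum c

    slope-≤-Γ : slope x (δ + w) ≤ 2# * Γ
    slope-≤-Γ = subst (slope x (δ + w) ≤_) (sym (*-distribˡ-sum 2# c))
      (sum-mono-≤ (λ i → Balanced.sᵣ (balanced i)))

    slope-decreases : slope x′ w ≤ slope x (δ + w)
    slope-decreases = sum-mono-≤ λ i → by (gap (a′≤a i) ⊞ gap (h≤h′ i))
      (solve 4 (λ a h a′ h′ → a :- h := a′ :- h′ :+ (a :- a′ :+ (h′ :- h))) refl (a i) (h i) (a′ i) (h′ i))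

    -- By concavity the actual gains are at least those predicted by the gradients at the new
    -- points. Returning to the old gradients costs (a - a′) r + (h′ - h) (1 - r) per coordinate and
    -- unit of time, at most the decrease of a - h.
    gain : δ * Γ + δ * slope x′ w ≤ F x′ - F x + (F y′ - F y) + δ * slope x (δ + w)
    gain = ≤-trans (subst₂ _≤_ (sum-linear δ δ c (λ i → a′ i - h′ i)) sum-u (sum-mono-≤ coordinate))
      (by (gap (rise-≥ 0≤x x≤x′ x′≤1) ⊞ gap (rise-≤ (λ i → 0≤x′ i ⊞ 0≤w) y′≤y y≤1))
        (solve 6 (λ X p q A H S → X :+ (p :- q) :+ S :=
            :1 :* (:1 :* A :+ :- :1 :* H) :+ S :+ (X :- A :+ (H :- (q :- p)))) refl
          (F x′ - F x) (F y′) (F y) (a′ ∙ (λ i → x′ i - x i)) (h′ ∙ (λ i → y i - y′ i)) (δ * slope x (δ + w))))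
      where
      x′≤1 : ∀ i → x′ i ≤ 1#
      x′≤1 i = ≤-trans (x′≤y′ i) (≤-trans (y′≤y i) (y≤1 i))
      u : Point n
      u i = 1# * (a′ i * (x′ i - x i)) + - 1# * (h′ i * (y i - y′ i))
      sum-u : sum (λ i → 1# * u i + δ * (a i - h i)) ≡
        1# * (1# * a′ ∙ (λ i → x′ i - x i) + - 1# * h′ ∙ (λ i → y i - y′ i)) + δ * slope x (δ + w)
      sum-u = trans (sum-linear 1# δ u (λ i → a i - h i))
        (cong (λ t → 1# * t + δ * slope x (δ + w))
          (sum-linear 1# (- 1#) (λ i → a′ i * (x′ i - x i)) (λ i → h′ i * (y i - y′ i))))
      coordinate : ∀ i → δ * c i + δ * (a′ i - h′ i) ≤ 1# * u i + δ * (a i - h i)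
      coordinate i = subst₂ (λ X Y → δ * c i + δ * (a′ i - h′ i) ≤ 1# * (1# * (a′ i * X) + - 1# * (h′ i * Y)) + δ * (a i - h i))
        (solve 2 (λ x e → e := x :+ e :- x) refl (x i) (δ * r i))
        (solve 4 (λ x δ r w → δ :* (:1 :- r) := x :+ (δ :+ w) :- (x :+ δ :* r :+ w)) refl (x i) δ (r i) w)
        (by (0≤δ ⊠ (gap (a′≤a i) ⊠ gap (fraction≤1 a h i) ⊞ gap (h≤h′ i) ⊠ 0≤fraction a h i))
          (solve 6 (λ δ r a h a′ h′ → :1 :* (:1 :* (a′ :* (δ :* r)) :+ :- :1 :* (h′ :* (δ :* (:1 :- r)))) :+ δ :* (a :- h) :=
              δ :* (a :* r :+ (:- h) :* (:1 :- r)) :+ δ :* (a′ :- h′) :+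
              δ :* ((a :- a′) :* (:1 :- r) :+ (h′ :- h) :* r)) refl
            δ (r i) (a i) (h i) (a′ i) (h′ i)))

    module _ (p : Point n) (x≤p : ∀ i → x i ≤ p i) (p≤y : ∀ i → p i ≤ y i) where

      private
        cl : ∀ i → Clamped (a i) (- h i) (r i) δ w (x i) (p i)
        cl i = clamp (0≤s i) (balanced i) (fraction≤1 a h i) 0≤δ 0≤w (x≤p i) (p≤y i)

        q : Point n
        q i = Clamped.q (cl i)

      p′ : Point n
      p′ i = Clamped.p′ (cl i)

      x′≤p′ : ∀ i → x′ i ≤ p′ i
      x′≤p′ i = Clamped.x′≤p′ (cl i)

      p′≤y′ : ∀ i → p′ i ≤ y′ i
      p′≤y′ i = Clamped.p′≤y′ (cl i)

      -- All points involved lie between `x` and `y`, so by antitonicity a rise loses at most -∇f(y)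
      -- and a fall at most ∇f(x) per unit; `Balanced` compares these with the rate.
      drop : 2# * (F p - F p′) ≤ δ * Γ
      drop = ≤-trans
        (by (0≤2 ⊠ (gap lower ⊞ gap upper))
          (solve 5 (λ P Q R A H → :2 :* A :+ :- :2 :* H := :2 :* (P :- R) :+ :2 :* (Q :- P :- H :+ (A :- (Q :- R)))) refl
            (F p) (F q) (F p′) A H))
        (subst₂ _≤_ (sum-linear 2# (- 2#) (λ i → a i * (q i - p′ i)) (λ i → h i * (q i - p i))) (sym (*-distribˡ-sum δ c))
          (sum-mono-≤ λ i → subst (_≤ δ * c i)
            (solve 4 (λ a h e d → :2 :* (:- h :* e :+ a :* d) := :2 :* (a :* d) :+ :- :2 :* (h :* e)) refl
              (a i) (h i) (q i - p i) (q i - p′ i))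
            (Clamped.drop (cl i))))
        where
        A = a ∙ (λ i → q i - p′ i)
        H = h ∙ (λ i → q i - p i)
        p≤q : ∀ i → p i ≤ q i
        p≤q i = Clamped.p≤q (cl i)
        p′≤q : ∀ i → p′ i ≤ q i
        p′≤q i = Clamped.p′≤q (cl i)
        q≤y : ∀ i → q i ≤ y i
        q≤y i = Clamped.q≤y (cl i)
        0≤p : ∀ i → 0# ≤ p i
        0≤p i = ≤-trans (0≤x i) (x≤p i)
        0≤p′ : ∀ i → 0# ≤ p′ i
        0≤p′ i = ≤-trans (0≤x′ i) (x′≤p′ i)
        q≤1 : ∀ i → q i ≤ 1#
        q≤1 i = ≤-trans (q≤y i) (y≤1 i)
        lower : H ≤ F q - F p
        lower = ≤-trans
          (∙-monoˡ-≤ (λ i → gap (p≤q i)) (antitone (λ i → ≤-trans (0≤p i) (p≤q i)) q≤y (λ _ → ≤-refl)))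
          (rise-≥ 0≤p p≤q q≤1)
        upper : F q - F p′ ≤ A
        upper = ≤-trans (rise-≤ 0≤p′ p′≤q q≤1)
          (∙-monoˡ-≤ (λ i → gap (p′≤q i)) (antitone 0≤x (λ i → ≤-trans (x≤x′ i) (x′≤p′ i))
            (λ i → ≤-trans (p′≤q i) (q≤y i))))

  -- The comparison point is clamped at every step, until the interval closes and it coincides with
  -- the output. The term `η * t * slope` bounds the error still to come: `Gradual` makes it cover
  -- the error of the present step and the same term at the later clock. The factor 2 - 4η remains
  -- because a fraction 2η of the first-order gain pays for η δ S.
  run-guarantee : ∀ {η ρ t} → 0# ≤ η → 0# ≤ 1# - 2# * η → 0# < ρ → 0# ≤ t →
    ∀ δs (0≤δs : NonNegatives δs) → Gradual η t δs →
    ∀ x 0≤x y≤1 → (∀ i → x i + duration δs + ρ ≤ 1#) →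
    ∀ p → (∀ i → x i ≤ p i) → (∀ i → p i ≤ x i + duration δs) →
    let O = f (output f ∇f (run δs 0≤δs x 0≤x y≤1)) in
    (2# - 2# * 2# * η) * (F p - O) ≤
    2# * O - F x - F (λ i → x i + duration δs) + η * t * slope x (duration δs)
  run-guarantee {η} {ρ} {t} 0≤η 0≤k 0<ρ 0≤t [] _ _ x 0≤x y≤1 y+ρ≤1 p x≤p p≤y =
    subst₂ (λ P Y → (2# - 2# * 2# * η) * (P - F x) ≤ 2# * F x - F x - Y + η * t * slope x 0#)
      (F-cong (λ i → antisym (x≤p i) (subst (p i ≤_) (+-identityʳ (x i)) (p≤y i))))
      (F-cong (λ i → sym (+-identityʳ (x i))))
      (by (0≤η ⊠ 0≤t ⊠ 0≤sum (λ i → gap (∇F-antitone x (λ j → x j + 0#) 0<ρ 0≤x (λ j → by ≤-refl refl) y+ρ≤1 i)))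
        (solve 3 (λ k X s → :2 :* X :- X :- X :+ s := k :* (X :- X) :+ s) refl
          (2# - 2# * 2# * η) (F x) (η * t * slope x 0#)))
  run-guarantee {η} {ρ} {t} 0≤η 0≤k 0<ρ 0≤t (δ ∷ δs) (0≤δ ∷ 0≤δs) (δ≤ , gradual) x 0≤x y≤1 y+ρ≤1 p x≤p p≤y =
    subst₂ _≤_
      (solve 4 (λ k a b c → k :* (b :- c) :+ k :* (a :- b) := k :* (a :- c)) refl k (F p) P′ O)
      (cong (_+ η * t * S)
        (solve 5 (λ o a b c d → o :- c :- d :+ (c :- a :+ (d :- b)) := o :- a :- b) refl (2# * O) (F x) (F y) (F x′) (F y′)))
      (by (gap IH ⊞ gap potential ⊞ gap telescope)
        (solve 7 (λ A B C D E X Y → D :+ E :+ C := A :+ B :+ (D :+ Y :- A :+ (E :+ X :- B) :+ (C :- (X :+ Y)))) refl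
          (k * (P′ - O)) (k * (F p - P′)) (η * t * S) R′ Δ (δ * S - δ * S′ - η * (δ * S)) (η * (t + δ) * S′)))
    where
    w = duration δs
    open Step 0<ρ 0≤δ (0≤duration 0≤δs) x 0≤x y+ρ≤1
    k S S′ O Δ R′ P′ : ℝ
    k  = 2# - 2# * 2# * η
    S  = slope x (δ + w)
    S′ = slope x′ w
    O  = f (output f ∇f (run (δ ∷ δs) (0≤δ ∷ 0≤δs) x 0≤x y≤1))
    Δ  = F x′ - F x + (F y′ - F y)
    R′ = 2# * O - F x′ - F y′
    P′ = F (p′ p x≤p p≤y)
    IH : k * (P′ - O) ≤ R′ + η * (t + δ) * S′
    IH = run-guarantee 0≤η 0≤k 0<ρ (0≤t ⊞ 0≤δ) δs 0≤δs gradual x′ _ _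
      (λ i → ≤-trans (+-mono-≤ ρ (advance-upper 0≤δ (∇F x) (∇F y) x w i)) (y+ρ≤1 i))
      (p′ p x≤p p≤y) (x′≤p′ p x≤p p≤y) (p′≤y′ p x≤p p≤y)
    potential : k * (F p - P′) ≤ Δ + (δ * S - δ * S′ - η * (δ * S))
    potential = step-potential 0≤η 0≤k (drop p x≤p p≤y)
      (subst (δ * S ≤_) (solve 2 (λ δ Γ → δ :* (:2 :* Γ) := :2 :* (δ :* Γ)) refl δ Γ) (*-mono-≤ 0≤δ slope-≤-Γ))
      gain
    telescope : δ * S - δ * S′ - η * (δ * S) + η * (t + δ) * S′ ≤ η * t * S
    telescope = by (gap δ≤ ⊠ gap slope-decreases)
      (solve 5 (λ δ η t S S′ → η :* t :* S := δ :* S :- δ :* S′ :- η :* (δ :* S) :+ η :* (t :+ δ) :* S′ :+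
        (η :* (t :+ δ) :- δ) :* (S :- S′)) refl δ η t S S′)

-- The geometric schedule of step sizes.

module Schedule (em : ExcludedMiddle 0ℓ) (𝓡 : CompleteOrderedField) where

  open DRSubmodularMaximization 𝓡
  open OrderedField em 𝓡
  open DoubleGreedy em 𝓡

  duration-replicate : ∀ m δ δs → duration (replicate m δ ++ δs) ≡ fromℕ m * δ + duration δs
  duration-replicate zero    δ δs = solve 2 (λ δ d → d := :0 :* δ :+ d) refl δ (duration δs)
  duration-replicate (suc m) δ δs = trans (cong (λ d → δ + d) (duration-replicate m δ δs))
    (solve 3 (λ m δ d → δ :+ (m :* δ :+ d) := (:1 :+ m) :* δ :+ d) refl (fromℕ m) δ (duration δs))

  -- The step length is tied to the time `s` at which the phase began. The clock only grows, so
  -- later steps of the phase satisfy the condition with more slack.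
  gradual-replicate : ∀ {η s} → 0# ≤ η → 0# ≤ s → ∀ m {t δs} → s ≤ t →
    Gradual η (t + fromℕ m * (η * s)) δs → Gradual η t (replicate m (η * s) ++ δs)
  gradual-replicate {η} {s} 0≤η 0≤s zero {t} {δs} s≤t =
    subst (λ t → Gradual η t δs) (solve 2 (λ t u → t :+ :0 :* u := t) refl t (η * s))
  gradual-replicate {η} {s} 0≤η 0≤s (suc m) {t} {δs} s≤t gradual =
    by (0≤η ⊠ (gap s≤t ⊞ 0≤η ⊠ 0≤s))
      (solve 3 (λ η s t → η :* (t :+ η :* s) := η :* s :+ η :* (t :- s :+ η :* s)) refl η s t) ,
    gradual-replicate 0≤η 0≤s m (≤-trans s≤t (by (0≤η ⊠ 0≤s) refl))
      (subst (λ t → Gradual η t δs)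
        (solve 3 (λ t m u → t :+ (:1 :+ m) :* u := t :+ u :+ m :* u) refl t (fromℕ m) (η * s)) gradual)

  -- With η = 1/M every phase consists of M equal steps and doubles the clock.
  module _ (M : ℕ) {η : ℝ} (0≤η : 0# ≤ η) (Mη≡1 : fromℕ M * η ≡ 1#) where

    phases : ℕ → ℝ → List ℝ
    phases zero    t = []
    phases (suc J) t = replicate M (η * t) ++ phases J (t + t)

    M[ηt]≡t : ∀ t → fromℕ M * (η * t) ≡ t
    M[ηt]≡t t = trans (sym (*-assoc (fromℕ M) η t)) (trans (cong (_* t) Mη≡1) (*-identityˡ t))

    duration-phases : ∀ J t → duration (phases J t) ≡ t * 2# ^ J - t
    duration-phases zero    t = solve 1 (λ t → :0 := t :* :1 :- t) refl t
    duration-phases (suc J) t = begin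
      duration (phases (suc J) t)                         ≡⟨ duration-replicate M (η * t) (phases J (t + t)) ⟩
      fromℕ M * (η * t) + duration (phases J (t + t))     ≡⟨ cong₂ _+_ (M[ηt]≡t t) (duration-phases J (t + t)) ⟩
      t + ((t + t) * 2# ^ J - (t + t))                    ≡⟨ solve 2 (λ t p → t :+ ((t :+ t) :* p :- (t :+ t)) := t :* (:2 :* p) :- t) refl t (2# ^ J) ⟩
      t * 2# ^ suc J - t                                  ∎
      where open ≡-Reasoning

    length-phases : ∀ J t → length (phases J t) ≡ J ℕ.* M
    length-phases zero    t = refl
    length-phases (suc J) t = trans (length-++ (replicate M (η * t)))
      (cong₂ ℕ._+_ (length-replicate M) (length-phases J (t + t)))

    0≤phases : ∀ J {t} → 0# ≤ t → NonNegatives (phases J t)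
    0≤phases zero    0≤t = []
    0≤phases (suc J) 0≤t = ++⁺ (replicate⁺ M (0≤η ⊠ 0≤t)) (0≤phases J (0≤t ⊞ 0≤t))

    gradual-phases : ∀ J {t} → 0# ≤ t → Gradual η t (phases J t)
    gradual-phases zero    0≤t = _
    gradual-phases (suc J) {t} 0≤t = gradual-replicate 0≤η 0≤t M ≤-refl
      (subst (λ u → Gradual η (t + u) (phases J (t + t))) (sym (M[ηt]≡t t)) (gradual-phases J (0≤t ⊞ 0≤t)))

-- The starting box and the approximation ratio.

module Approximation (em : ExcludedMiddle 0ℓ) (𝓡 : CompleteOrderedField) where

  open DRSubmodularMaximization 𝓡
  open OrderedField em 𝓡
  open Points em 𝓡
  open DoubleGreedy em 𝓡
  open Schedule em 𝓡

  output∈ : ∀ {n} f ∇f (alg : Algorithm n) → InCube (output f ∇f alg)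
  output∈ f ∇f (return (_ , x∈)) = x∈
  output∈ f ∇f (round zs next)   = output∈ f ∇f (next _)

  module _ (M J : ℕ) {η : ℝ} (0≤η : 0# ≤ η) (0≤k : 0# ≤ 1# - 2# * η) (Mη≡1 : fromℕ M * η ≡ 1#) where

    -- Chosen so that the clock, which doubles J times, runs for 2ᴶt₀ - t₀ = 1 - 2t₀,
    -- the initial distance between x = t₀ and y = 1 - t₀.
    t₀ : ℝ
    t₀ = (2# ^ J + 1#) ⁻¹

    δs : List ℝ
    δs = phases M 0≤η Mη≡1 J t₀

    0<t₀ : 0# < t₀
    0<t₀ = 0<⁻¹ (<-≤-trans 0<1 (by (0≤2^ J) (+-comm (2# ^ J) 1#)))

    [2ᴶ+1]t₀≡1 : (2# ^ J + 1#) * t₀ ≡ 1#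
    [2ᴶ+1]t₀≡1 = *⁻¹ (<-≤-trans 0<1 (by (0≤2^ J) (+-comm (2# ^ J) 1#)))

    private
      -- By the choice of `t₀` this is t₀ / (1 - t₀): a move by this fraction towards 1, then by the
      -- fraction t₀ towards 0, leaves equal margins t₀ at both ends.
      τ : ℝ
      τ = ½ ^ J

      0≤t₀ : 0# ≤ t₀
      0≤t₀ = proj₁ 0<t₀

      0≤δs : NonNegatives δs
      0≤δs = 0≤phases M 0≤η Mη≡1 J 0≤t₀

      y₀+t₀≡1 : t₀ + duration δs + t₀ ≡ 1#
      y₀+t₀≡1 = begin
        t₀ + duration δs + t₀         ≡⟨ cong (λ d → t₀ + d + t₀) (duration-phases M 0≤η Mη≡1 J t₀) ⟩
        t₀ + (t₀ * 2# ^ J - t₀) + t₀  ≡⟨ solve 2 (λ t p → t :+ (t :* p :- t) :+ t := (p :+ :1) :* t) refl t₀ (2# ^ J) ⟩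
        (2# ^ J + 1#) * t₀            ≡⟨ [2ᴶ+1]t₀≡1 ⟩
        1#                            ∎
        where open ≡-Reasoning

      y₀≤1 : t₀ + duration δs ≤ 1#
      y₀≤1 = ≤-trans (by 0≤t₀ refl) (≤-reflexive y₀+t₀≡1)

      τ[1-t₀] : τ * (1# - t₀) ≡ t₀
      τ[1-t₀] = begin
        τ * (1# - t₀)                    ≡⟨ cong (λ e → τ * (e - t₀)) [2ᴶ+1]t₀≡1 ⟨
        τ * ((2# ^ J + 1#) * t₀ - t₀)    ≡⟨ solve 3 (λ s p t → s :* ((p :+ :1) :* t :- t) := p :* s :* t) refl τ (2# ^ J) t₀ ⟩
        2# ^ J * τ * t₀                  ≡⟨ cong (_* t₀) (2^*½^ J) ⟩
        1# * t₀                          ≡⟨ *-identityˡ t₀ ⟩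
        t₀                               ∎
        where open ≡-Reasoning

      t₀≤1 : t₀ ≤ 1#
      t₀≤1 = ≤-trans (by (0≤duration 0≤δs ⊞ 0≤t₀) (solve 2 (λ t d → t :+ d :+ t := t :+ (d :+ t)) refl t₀ (duration δs)))
        (≤-reflexive y₀+t₀≡1)

      0≤1-2t₀ : 0# ≤ 1# - 2# * t₀
      0≤1-2t₀ = subst (0# ≤_)
        (trans (solve 2 (λ t d → d := t :+ d :+ t :- :2 :* t) refl t₀ (duration δs)) (cong (_- 2# * t₀) y₀+t₀≡1))
        (0≤duration 0≤δs)

    algorithm : ∀ n → Algorithm n
    algorithm n = run δs 0≤δs (λ _ → t₀) (λ _ → 0≤t₀) (λ _ → y₀≤1)

    rounds-algorithm : ∀ {n} f ∇f → rounds f ∇f (algorithm n) ≡ J ℕ.* M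
    rounds-algorithm f ∇f = trans (rounds-run f ∇f δs _ _ _ _) (length-phases M 0≤η Mη≡1 J t₀)

    evaluations-algorithm : ∀ {n} f ∇f → evaluations f ∇f (algorithm n) ≡ J ℕ.* M ℕ.* 2
    evaluations-algorithm f ∇f = trans (evaluations-run f ∇f δs _ _ _ _)
      (cong (ℕ._* 2) (length-phases M 0≤η Mη≡1 J t₀))

    module _ {n : ℕ} (f : Vec ℝ n → ℝ) (∇f : Vec ℝ n → Vec ℝ n)
      (nonneg : NonNegative f) (dr : DRSubmodular f) (grad : IsGradient f ∇f) where

      open DRCalculus em 𝓡 f ∇f dr grad
      open DoubleGreedyAnalysis em 𝓡 f ∇f dr grad

      private
        0≤F : ∀ {x} → Unit x → 0# ≤ F x
        0≤F x∈ = nonneg _ (inCube x∈)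

        x₀ y₀ : Point n
        x₀ _ = t₀
        y₀ _ = t₀ + duration δs

        0≤Fx₀ : 0# ≤ F x₀
        0≤Fx₀ = 0≤F (λ _ → 0≤t₀ , t₀≤1)

        0≤Fy₀ : 0# ≤ F y₀
        0≤Fy₀ = 0≤F (λ _ → 0≤t₀ ⊞ 0≤duration 0≤δs , y₀≤1)

        S : ℝ
        S = slope x₀ (duration δs)

        -- The gradient at `x₀` is bounded by the rise from 0 and the gradient at `y₀` by the rise
        -- to 1; nonnegativity at these two corners turns the rises into values.
        initial-slope : t₀ * S ≤ F x₀ + F y₀
        initial-slope = subst (_≤ F x₀ + F y₀) (sym scaled)
          (by (gap (rise-≥ {λ _ → 0#} {x₀} (λ _ → ≤-refl) (λ _ → 0≤t₀) (λ _ → t₀≤1))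
               ⊞ gap (rise-≤ {y₀} {λ _ → 1#} (λ _ → 0≤t₀ ⊞ 0≤duration 0≤δs) (λ _ → y₀≤1) (λ _ → ≤-refl))
               ⊞ 0≤F {λ _ → 0#} (λ _ → ≤-refl , 0≤1) ⊞ 0≤F {λ _ → 1#} (λ _ → 0≤1 , ≤-refl))
            (solve 6 (λ X Y Z O A H → X :+ Y := :1 :* A :+ :- :1 :* H :+ (X :- Z :- A :+ (H :- (O :- Y)) :+ Z :+ O)) refl
              (F x₀) (F y₀) (F (λ _ → 0#)) (F (λ _ → 1#)) (∇F x₀ ∙ (λ _ → t₀ - 0#)) (∇F y₀ ∙ (λ _ → 1# - y₀′))))
          where
          y₀′ = t₀ + duration δs
          scaled : t₀ * S ≡ 1# * ∇F x₀ ∙ (λ _ → t₀ - 0#) + - 1# * ∇F y₀ ∙ (λ _ → 1# - y₀′)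
          scaled = begin
            t₀ * S  ≡⟨ *-distribˡ-sum t₀ (λ i → ∇F x₀ i - ∇F y₀ i) ⟩
            sum (λ i → t₀ * (∇F x₀ i - ∇F y₀ i))
              ≡⟨ sum-cong-≗ (λ i → trans
                   (solve 4 (λ t a h y → t :* (a :- h) := :1 :* (a :* (t :- :0)) :+ :- :1 :* (h :* (y :+ t :- y))) refl
                     t₀ (∇F x₀ i) (∇F y₀ i) y₀′)
                   (cong (λ e → 1# * (∇F x₀ i * (t₀ - 0#)) + - 1# * (∇F y₀ i * (e - y₀′))) y₀+t₀≡1)) ⟩
            sum (λ i → 1# * (∇F x₀ i * (t₀ - 0#)) + - 1# * (∇F y₀ i * (1# - y₀′)))
              ≡⟨ sum-linear 1# (- 1#) (λ i → ∇F x₀ i * (t₀ - 0#)) (λ i → ∇F y₀ i * (1# - y₀′)) ⟩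
            1# * ∇F x₀ ∙ (λ _ → t₀ - 0#) + - 1# * ∇F y₀ ∙ (λ _ → 1# - y₀′) ∎
            where open ≡-Reasoning

      module _ (o : Point n) (o∈ : Unit o) where

        private
          -- Moving o towards 1 and then towards 0 amounts to the contraction
          -- (1 - 2t₀) o + t₀ of the cube onto [t₀ , 1 - t₀]ⁿ.
          m p₀ : Point n
          m i  = o i + τ * (1# - o i)
          p₀ i = 0# + (1# - t₀) * m i

          m∈ : Unit m
          m∈ i = proj₁ (o∈ i) ⊞ proj₁ (0<½^ J) ⊠ gap (proj₂ (o∈ i)) ,
            by (gap (½^≤1 J) ⊠ gap (proj₂ (o∈ i)))
              (solve 2 (λ o s → :1 := o :+ s :* (:1 :- o) :+ (:1 :- s) :* (:1 :- o)) refl (o i) τ)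

          t₀≤p₀ : ∀ i → t₀ ≤ p₀ i
          t₀≤p₀ i = by (0≤1-2t₀ ⊠ proj₁ (o∈ i)) (begin
            0# + (1# - t₀) * (o i + τ * (1# - o i))
              ≡⟨ solve 3 (λ o s t → :0 :+ (:1 :- t) :* (o :+ s :* (:1 :- o)) := (:1 :- t) :* o :+ s :* (:1 :- t) :* (:1 :- o)) refl (o i) τ t₀ ⟩
            (1# - t₀) * o i + τ * (1# - t₀) * (1# - o i)
              ≡⟨ cong (λ e → (1# - t₀) * o i + e * (1# - o i)) τ[1-t₀] ⟩
            (1# - t₀) * o i + t₀ * (1# - o i)
              ≡⟨ solve 2 (λ o t → (:1 :- t) :* o :+ t :* (:1 :- o) := t :+ (:1 :- :2 :* t) :* o) refl (o i) t₀ ⟩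
            t₀ + (1# - 2# * t₀) * o i ∎)
            where open ≡-Reasoning

          p₀≤y₀ : ∀ i → p₀ i ≤ y₀ i
          p₀≤y₀ i = by (gap t₀≤1 ⊠ gap (proj₂ (m∈ i)))
            (trans (solve 2 (λ t y → y := y :+ t :- t) refl t₀ (t₀ + duration δs))
              (trans (cong (_- t₀) y₀+t₀≡1)
                (solve 2 (λ t m → :1 :- t := :0 :+ (:1 :- t) :* m :+ (:1 :- t) :* (:1 :- m)) refl t₀ (m i))))

          -- The contraction as a whole has no sign, so concavity does not apply to it; it does
          -- apply to the move towards 1 and to the one away from 0. As f is nonnegative at the
          -- corner, each move costs only its fraction.
          Fm-≥ : (1# - τ) * F o ≤ F m
          Fm-≥ = ≤-trans (by (proj₁ (0<½^ J) ⊠ 0≤F top∈) refl)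
            (F-concave o (λ i → 1# - o i) (λ i → proj₁ (o∈ i)) (λ i → gap (proj₂ (o∈ i))) (λ i → proj₂ (top∈ i))
              (proj₁ (0<½^ J)) (½^≤1 J))
            where
            top∈ : Unit (λ i → o i + (1# - o i))
            top∈ i = subst (λ t → 0# ≤ t × t ≤ 1#) (solve 1 (λ o → :1 := o :+ (:1 :- o)) refl (o i)) (0≤1 , ≤-refl)

          Fp₀-≥-Fm : (1# - t₀) * F m ≤ F p₀
          Fp₀-≥-Fm = ≤-trans
            (by (0≤t₀ ⊠ 0≤F {λ _ → 0#} (λ _ → ≤-refl , 0≤1))
              (trans (solve 3 (λ t z m → (:1 :- (:1 :- t)) :* z :+ (:1 :- t) :* m := (:1 :- t) :* m :+ t :* z) refl t₀ (F (λ _ → 0#)) (F (λ i → 0# + m i)))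
                (cong (λ e → (1# - t₀) * e + t₀ * F (λ _ → 0#)) (F-cong (λ i → +-identityˡ (m i))))))
            (F-concave (λ _ → 0#) m (λ _ → ≤-refl) (λ i → proj₁ (m∈ i))
              (λ i → subst (_≤ 1#) (sym (+-identityˡ (m i))) (proj₂ (m∈ i)))
              (gap t₀≤1) (by 0≤t₀ (solve 1 (λ t → :1 := :1 :- t :+ t) refl t₀)))

          Fp₀-≥ : (1# - 2# * t₀) * F o ≤ F p₀
          Fp₀-≥ = ≤-trans (≤-reflexive (begin
              (1# - 2# * t₀) * F o
                ≡⟨ solve 2 (λ t X → (:1 :- :2 :* t) :* X := (:1 :- t :- t) :* X) refl t₀ (F o) ⟩
              (1# - t₀ - t₀) * F o
                ≡⟨ cong (λ e → (1# - t₀ - e) * F o) τ[1-t₀] ⟨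
              (1# - t₀ - τ * (1# - t₀)) * F o
                ≡⟨ solve 3 (λ t s X → (:1 :- t :- s :* (:1 :- t)) :* X := (:1 :- t) :* ((:1 :- s) :* X)) refl t₀ τ (F o) ⟩
              (1# - t₀) * ((1# - τ) * F o) ∎))
            (≤-trans (*-mono-≤ (gap t₀≤1) Fm-≥) Fp₀-≥-Fm)
            where open ≡-Reasoning

        out : ℝ
        out = f (output f ∇f (algorithm n))

        0≤out : 0# ≤ out
        0≤out = nonneg _ (output∈ f ∇f (algorithm n))

        approximation : (2# - 2# * 2# * η) * ((1# - 2# * t₀) * F o) ≤ 2# * 2# * out
        approximation = ≤-trans (*-mono-≤ 0≤2-4η Fp₀-≥)
          -- Since η ≤ 1, the subtracted values at `x₀` and `y₀` absorb η t₀ S. Moving `out` across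
          -- makes its factor 4 - 4η, and 4η `out` is given away.
          (by (gap run-bound ⊞ 0≤η ⊠ gap initial-slope ⊞ 0≤k ⊠ 0≤u ⊞ 0≤η ⊠ 0≤u ⊞ 0≤2 ⊠ (0≤2 ⊠ (0≤η ⊠ 0≤out)))
            (solve 6 (λ P O X Y η s → :2 :* :2 :* O := (:2 :- :2 :* :2 :* η) :* P :+
                (:2 :* O :- X :- Y :+ η :* s :- (:2 :- :2 :* :2 :* η) :* (P :- O) :+ η :* (X :+ Y :- s) :+
                 (:1 :- :2 :* η) :* (X :+ Y) :+ η :* (X :+ Y) :+ :2 :* (:2 :* (η :* O)))) refl
              (F p₀) out (F x₀) (F y₀) η (t₀ * S)))
          where
          0≤u : 0# ≤ F x₀ + F y₀
          0≤u = 0≤Fx₀ ⊞ 0≤Fy₀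
          0≤2-4η : 0# ≤ 2# - 2# * 2# * η
          0≤2-4η = subst (0# ≤_) (solve 1 (λ η → :2 :* (:1 :- :2 :* η) := :2 :- :2 :* :2 :* η) refl η) (0≤2 ⊠ 0≤k)
          run-bound : (2# - 2# * 2# * η) * (F p₀ - out) ≤ 2# * out - F x₀ - F y₀ + η * (t₀ * S)
          run-bound = subst (λ e → (2# - 2# * 2# * η) * (F p₀ - out) ≤ 2# * out - F x₀ - F y₀ + e) (*-assoc η t₀ S)
            (run-guarantee 0≤η 0≤k 0<t₀ 0≤t₀ δs 0≤δs (gradual-phases M 0≤η Mη≡1 J 0≤t₀)
              x₀ (λ _ → 0≤t₀) (λ _ → y₀≤1) (λ _ → ≤-reflexive y₀+t₀≡1) p₀ t₀≤p₀ p₀≤y₀)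

-- Choice of the parameters and query counts.

module Parameters (em : ExcludedMiddle 0ℓ) (𝓡 : CompleteOrderedField) where

  open DRSubmodularMaximization 𝓡
  open OrderedField em 𝓡
  open Points em 𝓡
  open Approximation em 𝓡

  -- The constant 18 counts two evaluations per round, at most 3ℓ phases and at most 3/ε rounds in
  -- each.
  3# C : ℝ
  3# = 2# + 1#
  C  = 2# * (3# * 3#)

  Guarantee : ℝ → (∀ n → Algorithm n) → Set
  Guarantee ε alg = ∀ (n : ℕ) (f : Vec ℝ n → ℝ) (∇f : Vec ℝ n → Vec ℝ n) →
    NonNegative f → DRSubmodular f → IsGradient f ∇f →
    (∀ z → InCube z → (½ - ε) * f z ≤ f (output f ∇f (alg n)))
    × (ε < 1# → Σ[ ℓ ∈ ℝ ] IsLog₂ (ε ⁻¹) ℓ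
        × (fromℕ (rounds f ∇f (alg n)) ≤ C * (ℓ * ε ⁻¹))
        × (fromℕ (evaluations f ∇f (alg n)) ≤ C * (ℓ * ε ⁻¹)))

  0≤3 : 0# ≤ 3#
  0≤3 = 0≤2 ⊞ 0≤1

  0≤C : 0# ≤ C
  0≤C = 0≤2 ⊠ (0≤3 ⊠ 0≤3)

  module _ {ε : ℝ} (0<ε : 0# < ε) where

    private
      0≤ε : 0# ≤ ε
      0≤ε = proj₁ 0<ε

      ε[cε⁻¹]≡c : ∀ c → ε * (c * ε ⁻¹) ≡ c
      ε[cε⁻¹]≡c c = trans (solve 3 (λ ε c i → ε :* (c :* i) := c :* (ε :* i)) refl ε c (ε ⁻¹))
        (trans (cong (c *_) (*⁻¹ 0<ε)) (*-identityʳ c))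

      ≤-divide : ∀ {x c} → ε * x ≤ c → x ≤ c * ε ⁻¹
      ≤-divide {x} {c} εx≤c = *-cancel-≤ 0<ε (subst (ε * x ≤_) (sym (ε[cε⁻¹]≡c c)) εx≤c)

      ≤-multiply : ∀ {c x} → c * ε ⁻¹ ≤ x → c ≤ ε * x
      ≤-multiply {c} {x} c/ε≤x = subst (_≤ ε * x) (ε[cε⁻¹]≡c c) (*-mono-≤ 0≤ε c/ε≤x)

    1≤ε⁻¹ : ε < 1# → 1# ≤ ε ⁻¹
    1≤ε⁻¹ (ε≤1 , _) = subst (1# ≤_) (*-identityˡ (ε ⁻¹)) (≤-divide (subst (_≤ 1#) (sym (*-identityʳ ε)) ε≤1))

    log : ε < 1# → ∃[ ℓ ] IsLog₂ (ε ⁻¹) ℓ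
    log ε<1 = IsLog₂-exists (ε ⁻¹) (1≤ε⁻¹ ε<1)

    -- The value asked for is at most 0, so nonnegativity lets a fixed point be returned without
    -- queries.
    trivial : ½ ≤ ε → ∃[ alg ] Guarantee ε alg
    trivial ½≤ε = (λ n → return (tabulate (λ _ → 0#) , origin∈)) , λ n f ∇f nonneg _ _ →
      (λ z z∈ → by (gap ½≤ε ⊠ nonneg z z∈ ⊞ nonneg _ origin∈)
        (solve 4 (λ h ε X O → O := (h :- ε) :* X :+ ((ε :- h) :* X :+ O)) refl ½ ε (f z) (f (tabulate (λ _ → 0#))))) ,
      λ ε<1 → let ℓ , isLog = log ε<1 in ℓ , isLog , 0≤bound ε<1 ℓ isLog , 0≤bound ε<1 ℓ isLog
      where
      origin∈ : ∀ {n} → InCube (tabulate {n = n} (λ _ → 0#))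
      origin∈ = inCube (λ _ → ≤-refl , 0≤1)
      0≤bound : ε < 1# → ∀ ℓ → IsLog₂ (ε ⁻¹) ℓ → 0# ≤ C * (ℓ * ε ⁻¹)
      0≤bound ε<1 ℓ isLog = 0≤C ⊠ (IsLog₂-≥ 0 isLog (1≤ε⁻¹ ε<1) ⊠ 0≤⁻¹ 0<ε)

    -- The lower bound will give 2η ≤ ε for η = 1/M. Rounding 2/ε up adds at most ε ≤ 1 to ε M,
    -- whence 3.
    mesh : ε ≤ 1# → ∃[ M ] 2# ≤ ε * fromℕ M × ε * fromℕ M ≤ 3#
    mesh ε≤1 with archimedean (2# * ε ⁻¹)
    ... | K , 2/ε≤K with leastℕ (λ k → 2# ≤ ε * fromℕ k) K (≤-multiply 2/ε≤K)
    ... | zero  , 2≤ε0 , _     = contradiction (subst (2# ≤_) (zeroʳ ε) 2≤ε0) (<⇒≱ 0<2)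
    ... | suc M , 2≤εM , least = suc M , 2≤εM ,
      by (gap ε≤1 ⊞ gap (≰⇒≥ (least M refl)))
        (solve 2 (λ ε m → :2 :+ :1 := ε :* (:1 :+ m) :+ (:1 :- ε :+ (:2 :- ε :* m))) refl ε (fromℕ M))

    depth : ε < 1# → ∃[ J ] 1# ≤ ε * 2# ^ suc J × ε * 2# ^ J ≤ 1#
    depth ε<1 with 2^-unbounded (1# * ε ⁻¹)
    ... | K , 1/ε≤2ᴷ with leastℕ (λ k → 1# ≤ ε * 2# ^ k) K (≤-multiply 1/ε≤2ᴷ)
    ... | zero  , 1≤ε   , _     = contradiction (subst (1# ≤_) (*-identityʳ ε) 1≤ε) (<⇒≱ ε<1)
    ... | suc J , 1≤ε2ᴶ , least = J , 1≤ε2ᴶ , ≰⇒≥ (least J refl)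

    scheduled : ¬ ½ ≤ ε → ∃[ alg ] Guarantee ε alg
    -- Of the two phases beyond `J`, one makes up for rounding log₂(1/ε) down, the other supplies
    -- the factor 2 in 2t₀ ≤ ε.
    scheduled ½≰ε = algorithm M (2 ℕ.+ J) 0≤η 0≤1-2η Mη≡1 , λ n f ∇f nonneg dr grad →
      (λ z z∈ → *-cancel-≤ (0<* 0<2 0<2) (≤-trans
        (by (0≤slack ⊠ nonneg z z∈) (factor (f z)))
        (subst (λ v → (2# - 2# * 2# * η) * ((1# - 2# * t) * f v) ≤ _) (tabulate∘lookup z)
          (approximation M (2 ℕ.+ J) 0≤η 0≤1-2η Mη≡1 f ∇f nonneg dr grad (lookup z) (lookup⁺ z∈))))) ,
      λ _ → let ℓ , isLog = log ε<1 in ℓ , isLog ,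
        subst (λ k → fromℕ k ≤ C * (ℓ * ε ⁻¹)) (sym (rounds-algorithm M (2 ℕ.+ J) 0≤η 0≤1-2η Mη≡1 f ∇f))
          (≤-trans (fromℕ-mono (m≤m*n ((2 ℕ.+ J) ℕ.* M) 2)) (bound ℓ isLog)) ,
        subst (λ k → fromℕ k ≤ C * (ℓ * ε ⁻¹)) (sym (evaluations-algorithm M (2 ℕ.+ J) 0≤η 0≤1-2η Mη≡1 f ∇f))
          (bound ℓ isLog)
      where
      2ε≤1 : ε * 2# ≤ 1#
      2ε≤1 = subst₂ _≤_ (*-comm 2# ε) 2*½ (*-mono-≤ 0≤2 (≰⇒≥ ½≰ε))
      ε<1 : ε < 1#
      ε<1 = ≰⇒> λ 1≤ε → <⇒≱ 0<1 (by (gap 2ε≤1 ⊞ gap 1≤ε ⊞ gap 1≤ε)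
        (solve 1 (λ ε → :0 := :1 :+ (:1 :- ε :* :2 :+ (ε :- :1) :+ (ε :- :1))) refl ε))
      M J : ℕ
      M = proj₁ (mesh (proj₁ ε<1))
      J = proj₁ (depth ε<1)
      2≤εM : 2# ≤ ε * fromℕ M
      2≤εM = proj₁ (proj₂ (mesh (proj₁ ε<1)))
      εM≤3 : ε * fromℕ M ≤ 3#
      εM≤3 = proj₂ (proj₂ (mesh (proj₁ ε<1)))
      1≤ε2ᴶ⁺¹ : 1# ≤ ε * 2# ^ suc J
      1≤ε2ᴶ⁺¹ = proj₁ (proj₂ (depth ε<1))
      ε2ᴶ≤1 : ε * 2# ^ J ≤ 1#
      ε2ᴶ≤1 = proj₂ (proj₂ (depth ε<1))
      0<M : 0# < fromℕ M
      0<M = ≰⇒> λ M≤0 → <⇒≱ 0<2 (by (gap 2≤εM ⊞ 0≤ε ⊠ gap M≤0)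
        (solve 2 (λ ε m → :0 := :2 :+ (ε :* m :- :2 :+ ε :* (:0 :- m))) refl ε (fromℕ M)))
      η : ℝ
      η = fromℕ M ⁻¹
      Mη≡1 : fromℕ M * η ≡ 1#
      Mη≡1 = *⁻¹ 0<M
      0≤η : 0# ≤ η
      0≤η = 0≤⁻¹ 0<M
      2η≤ε : 2# * η ≤ ε
      2η≤ε = by (gap 2≤εM ⊠ 0≤η) (begin
        ε                                   ≡⟨ *-identityʳ ε ⟨
        ε * 1#                              ≡⟨ cong (ε *_) Mη≡1 ⟨
        ε * (fromℕ M * η)                   ≡⟨ solve 3 (λ ε m η → ε :* (m :* η) := :2 :* η :+ (ε :* m :- :2) :* η) refl ε (fromℕ M) η ⟩
        2# * η + (ε * fromℕ M - 2#) * η     ∎)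
        where open ≡-Reasoning
      0≤1-2η : 0# ≤ 1# - 2# * η
      0≤1-2η = gap (≤-trans 2η≤ε (proj₁ ε<1))
      t : ℝ
      t = t₀ M (2 ℕ.+ J) 0≤η 0≤1-2η Mη≡1
      0≤t : 0# ≤ t
      0≤t = proj₁ (0<t₀ M (2 ℕ.+ J) 0≤η 0≤1-2η Mη≡1)
      2t≤ε : 2# * t ≤ ε
      2t≤ε = by (0≤2 ⊠ (gap 1≤ε2ᴶ⁺¹ ⊠ 0≤t) ⊞ 0≤ε ⊠ 0≤t) (begin
        ε                                   ≡⟨ *-identityʳ ε ⟨
        ε * 1#                              ≡⟨ cong (ε *_) ([2ᴶ+1]t₀≡1 M (2 ℕ.+ J) 0≤η 0≤1-2η Mη≡1) ⟨
        ε * ((2# ^ (2 ℕ.+ J) + 1#) * t)     ≡⟨ solve 3 (λ ε p t → ε :* ((:2 :* p :+ :1) :* t) := :2 :* t :+ (:2 :* ((ε :* p :- :1) :* t) :+ ε :* t)) refl ε (2# ^ suc J) t ⟩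
        2# * t + (2# * ((ε * 2# ^ suc J - 1#) * t) + ε * t) ∎)
        where open ≡-Reasoning
      -- Four times the excess of (½ - η) (1 - 2t) over ½ - ε.
      slack : ℝ
      slack = 2# * (ε - 2# * η) + 2# * (ε - 2# * t) + 2# * 2# * (2# * η * t)
      0≤slack : 0# ≤ slack
      0≤slack = 0≤2 ⊠ gap 2η≤ε ⊞ 0≤2 ⊠ gap 2t≤ε ⊞ 0≤2 ⊠ 0≤2 ⊠ (0≤2 ⊠ 0≤η ⊠ 0≤t)
      factor : ∀ X → (2# - 2# * 2# * η) * ((1# - 2# * t) * X) ≡ 2# * 2# * ((½ - ε) * X) + slack * X
      factor X = begin
        (2# - 2# * 2# * η) * ((1# - 2# * t) * X)
          ≡⟨ solve 4 (λ ε η t X → (:2 :- :2 :* :2 :* η) :* ((:1 :- :2 :* t) :* X) :=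
               :2 :* (:1 :- :2 :* ε) :* X :+
               (:2 :* (ε :- :2 :* η) :+ :2 :* (ε :- :2 :* t) :+ :2 :* :2 :* (:2 :* η :* t)) :* X) refl ε η t X ⟩
        2# * (1# - 2# * ε) * X + slack * X
          ≡⟨ cong (λ e → 2# * (e - 2# * ε) * X + slack * X) 2*½ ⟨
        2# * (2# * ½ - 2# * ε) * X + slack * X
          ≡⟨ cong (_+ slack * X) (solve 3 (λ h ε X → :2 :* (:2 :* h :- :2 :* ε) :* X := :2 :* :2 :* ((h :- ε) :* X)) refl ½ ε X) ⟩
        2# * 2# * ((½ - ε) * X) + slack * X ∎
        where open ≡-Reasoning
      bound : ∀ ℓ → IsLog₂ (ε ⁻¹) ℓ → fromℕ ((2 ℕ.+ J) ℕ.* M ℕ.* 2) ≤ C * (ℓ * ε ⁻¹)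
      bound ℓ isLog = subst (_≤ C * (ℓ * i)) (sym count)
        (by (0≤2 ⊠ (gap j≤3ℓ ⊠ 0≤fromℕ M ⊞ 0≤3 ⊠ 0≤ℓ ⊠ gap M≤3i))
          (solve 4 (λ j m ℓ i → :2 :* ((:2 :+ :1) :* (:2 :+ :1)) :* (ℓ :* i) := j :* m :* (:1 :+ (:1 :+ :0)) :+
            :2 :* (((:2 :+ :1) :* ℓ :- j) :* m :+ (:2 :+ :1) :* ℓ :* ((:2 :+ :1) :* i :- m))) refl
            (fromℕ (2 ℕ.+ J)) (fromℕ M) ℓ i))
        where
        i = ε ⁻¹
        count : fromℕ ((2 ℕ.+ J) ℕ.* M ℕ.* 2) ≡ fromℕ (2 ℕ.+ J) * fromℕ M * fromℕ 2
        count = trans (×1-homo-* ((2 ℕ.+ J) ℕ.* M) 2) (cong (_* fromℕ 2) (×1-homo-* (2 ℕ.+ J) M))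
        -- As ε ≤ ½, the logarithm is at least 1 and absorbs the two additional phases.
        1≤ℓ : 1# ≤ ℓ
        1≤ℓ = subst (_≤ ℓ) (+-identityʳ 1#) (IsLog₂-≥ 1 isLog
          (subst₂ _≤_ (sym (*-identityʳ 2#)) (*-identityˡ i) (≤-divide 2ε≤1)))
        0≤ℓ : 0# ≤ ℓ
        0≤ℓ = ≤-trans 0≤1 1≤ℓ
        J≤ℓ : fromℕ J ≤ ℓ
        J≤ℓ = IsLog₂-≥ J isLog (subst (2# ^ J ≤_) (*-identityˡ i) (≤-divide ε2ᴶ≤1))
        j≤3ℓ : fromℕ (2 ℕ.+ J) ≤ 3# * ℓ
        j≤3ℓ = by (gap J≤ℓ ⊞ gap 1≤ℓ ⊞ gap 1≤ℓ)
          (solve 2 (λ j ℓ → (:2 :+ :1) :* ℓ := :1 :+ (:1 :+ j) :+ (ℓ :- j :+ (ℓ :- :1) :+ (ℓ :- :1))) refl (fromℕ J) ℓ)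
        M≤3i : fromℕ M ≤ 3# * i
        M≤3i = ≤-divide εM≤3

    solution : ∃[ alg ] Guarantee ε alg
    solution with em {½ ≤ ε}
    ... | yes ½≤ε = trivial ½≤ε
    ... | no  ½≰ε = scheduled ½≰ε

theorem1 : ExcludedMiddle 0ℓ → (𝓡 : CompleteOrderedField) →
    let open DRSubmodularMaximization 𝓡 in
    Σ[ C ∈ ℝ ] (∀ (ε : ℝ) → 0# < ε →
    Σ[ alg ∈ (∀ n → Algorithm n) ]
    (∀ (n : ℕ) (f : Vec ℝ n → ℝ) (∇f : Vec ℝ n → Vec ℝ n) →
    NonNegative f → DRSubmodular f → IsGradient f ∇f →
    (∀ z → InCube z → (½ - ε) * f z ≤ f (output f ∇f (alg n)))
    × (ε < 1# →
    Σ[ ℓ ∈ ℝ ] IsLog₂ (ε ⁻¹) ℓ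
    × (fromℕ (rounds f ∇f (alg n)) ≤ C * (ℓ * ε ⁻¹))
    × (fromℕ (evaluations f ∇f (alg n)) ≤ C * (ℓ * ε ⁻¹)))))
theorem1 em 𝓡 = C , λ ε 0<ε → solution 0<ε
  where open Parameters em 𝓡
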